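{- The Erdős–Hajnal coefficient of the directed path $P_k$ satisfies $$\epsilon(P_k)=\frac{1}{k^{1+o(1)}}\qquad\text{as } k\to\infty.$$
   Context: All graphs are finite and simple. A tournament is a directed graph in which for every two distinct vertices $u,v$ exactly one of $(u,v),(v,u)$ is an edge. A tournament is transitive if it contains no directed cycle. A tournament $T$ is $H$-free if it has no induced subtournament isomorphic to $H$. The directed path $P_k$ is the tournament with vertex set $\{v_1,\dots,v_k\}$ in which, for $1\le i<j\le k$, the edge between $v_i$ and $v_j$ is $(v_j,v_i)$ if $j=i+1$ and $(v_i,v_j)$ otherwise. For a tournament $H$, the Erdős–Hajnal coefficient $\epsilon(H)$ is the supremum of all $\epsilon\ge 0$ such that every $H$-free tournament $T$ (with at least one vertex) contains a transitive subtournament of order at least $|T|^{\epsilon}$, where $|T|$ is the number of vertices of $T$. -}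

module Defs where

open import Data.Empty using (⊥-elim)
open import Data.Fin.Base using (Fin; zero; suc; toℕ; fromℕ; inject₁)
open import Data.Fin.Properties using (toℕ-injective)
open import Data.Integer.Base using (ℤ; +_; -[1+_]; ∣_∣)
open import Data.Nat.Base as ℕ using (ℕ; suc)
import Data.Nat.Properties as ℕₚ
open import Data.Product.Base using (Σ; ∃; _×_; _,_)
open import Data.Rational.Unnormalised.Base using (ℚᵘ; 0ℚᵘ; ↥_; ↧ₙ_; _≤_; _<_)
import Data.Rational.Unnormalised.Properties as ℚₚ
open import Data.Sum.Base using (_⊎_; inj₁; inj₂)
open import Function.Base using (_∘_)
open import Function.Bundles using (_↣_; _↔_; _⇔_; Injection; Inverse)
open import Function.Definitions using (Injective)
open import Level using (Level; 0ℓ; _⊔_) renaming (suc to lsuc)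
open import Relation.Binary.Core using (Rel)
open import Relation.Binary.Definitions using (tri<; tri≈; tri>)
open import Relation.Binary.PropositionalEquality using (_≡_; _≢_; refl; sym)
open import Relation.Nullary.Decidable.Core using (yes; no)
open import Relation.Nullary.Negation.Core using (¬_)

record Tournament (n : ℕ) : Set₁ where
  field
    Edge       : Rel (Fin n) 0ℓ
    irrefl     : ∀ u → ¬ Edge u u
    exactlyOne : ∀ u v → u ≢ v →
                 (Edge u v × ¬ Edge v u) ⊎ (Edge v u × ¬ Edge u v)

open Tournament public using (Edge)

-- A vertex subset of size m is given by an injective enumeration of it.
induced : ∀ {m n} → Tournament n → Fin m ↣ Fin n → Tournament m
induced T f = record
  { Edge       = λ i j → Edge T (to i) (to j)
  ; irrefl     = λ i → Tournament.irrefl T (to i)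
  ; exactlyOne = λ i j i≢j →
      Tournament.exactlyOne T (to i) (to j) (i≢j ∘ injective)
  }
  where open Injection f using (to; injective)

record _≅_ {m n} (S : Tournament m) (T : Tournament n) : Set where
  field
    bijection : Fin m ↔ Fin n
    edges     : ∀ u v →
      Edge S u v ⇔ Edge T (Inverse.to bijection u) (Inverse.to bijection v)

_-Free_ : ∀ {h n} → Tournament h → Tournament n → Set
_-Free_ {n = n} H T =
  ¬ (Σ ℕ λ m → Σ (Fin m ↣ Fin n) λ f → induced T f ≅ H)

-- The cycle  c 0 → c 1 → ⋯ → c ℓ → c 0  on ℓ + 1 distinct vertices.
record DirectedCycle {n} (T : Tournament n) : Set where
  field
    ℓ        : ℕ
    c        : Fin (suc ℓ) → Fin n
    distinct : Injective _≡_ _≡_ c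
    step     : ∀ (i : Fin ℓ) → Edge T (c (inject₁ i)) (c (suc i))
    close    : Edge T (c (fromℕ ℓ)) (c zero)

Transitive : ∀ {n} → Tournament n → Set
Transitive T = ¬ DirectedCycle T

-- Consecutive vertices are joined backwards, all other pairs forwards.
PathEdge : ∀ {k} → Rel (Fin k) 0ℓ
PathEdge u v =
    (toℕ u ≡ suc (toℕ v))
  ⊎ (toℕ u ℕ.< toℕ v × toℕ v ≢ suc (toℕ u))

private
  path-irrefl : ∀ {k} (u : Fin k) → ¬ PathEdge u u
  path-irrefl u (inj₁ eq)        = ℕₚ.1+n≢n (sym eq)
  path-irrefl u (inj₂ (u<u , _)) = ℕₚ.<-irrefl refl u<u

  path-asym : ∀ {k} (u v : Fin k) → PathEdge u v → ¬ PathEdge v u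
  path-asym u v (inj₁ p) (inj₁ q) =
    ℕₚ.<-asym (ℕₚ.≤-reflexive (sym p)) (ℕₚ.≤-reflexive (sym q))
  path-asym u v (inj₁ p)         (inj₂ (_ , ≢)) = ≢ p
  path-asym u v (inj₂ (_ , ≢))   (inj₁ q)       = ≢ q
  path-asym u v (inj₂ (u<v , _)) (inj₂ (v<u , _)) = ℕₚ.<-asym u<v v<u

  path-total : ∀ {k} (u v : Fin k) → u ≢ v → PathEdge u v ⊎ PathEdge v u
  path-total u v u≢v with ℕₚ.<-cmp (toℕ u) (toℕ v)
  ... | tri≈ _ eq _ = ⊥-elim (u≢v (toℕ-injective eq))
  ... | tri< u<v _ _ with toℕ v ℕₚ.≟ suc (toℕ u)
  ...   | yes eq = inj₂ (inj₁ eq)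
  ...   | no ≢   = inj₁ (inj₂ (u<v , ≢))
  path-total u v u≢v | tri> _ _ v<u with toℕ u ℕₚ.≟ suc (toℕ v)
  ...   | yes eq = inj₁ (inj₁ eq)
  ...   | no ≢   = inj₂ (inj₂ (v<u , ≢))

P : (k : ℕ) → Tournament k
P k = record
  { Edge       = PathEdge
  ; irrefl     = path-irrefl
  ; exactlyOne = λ u v u≢v → exactly u v (path-total u v u≢v)
  }
  where
  exactly : (u v : Fin k) → PathEdge u v ⊎ PathEdge v u →
            (PathEdge u v × ¬ PathEdge v u) ⊎ (PathEdge v u × ¬ PathEdge u v)
  exactly u v (inj₁ e) = inj₁ (e , path-asym u v e)
  exactly u v (inj₂ e) = inj₂ (e , path-asym v u e)

-- Real numbers are represented by their strict lower cuts  { q ∈ ℚ | q < x }.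
-- Every set of rationals then has a supremum (possibly ±∞).

record LowerReal (ℓ : Level) : Set (lsuc ℓ) where
  field
    Below   : ℚᵘ → Set ℓ
    closed  : ∀ {p q} → p < q → Below q → Below p
    rounded : ∀ {p} → Below p → ∃ λ q → p < q × Below q

open LowerReal public using (Below)

infix 4 _≤ᴿ_

_≤ᴿ_ : ∀ {a b} → LowerReal a → LowerReal b → Set (a ⊔ b)
x ≤ᴿ y = ∀ q → Below x q → Below y q

sup : ∀ {ℓ} → (ℚᵘ → Set ℓ) → LowerReal ℓ
sup A = record
  { Below   = λ q → ∃ λ r → A r × q < r
  ; closed  = λ { p<q (r , Ar , q<r) → r , Ar , ℚₚ.<-trans p<q q<r }
  ; rounded = λ { (r , Ar , p<r) →
      let (m , p<m , m<r) = ℚₚ.<-dense p<r in m , p<m , (r , Ar , m<r) }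
  }

-- For s = c / d and r = a / b ≥ 0, the inequality r ≤ k ^ (- s) is
-- a ^ d * k ^ c ≤ b ^ d, with the power of k moved across when c < 0.
AtMostPower : ℚᵘ → ℕ → ℚᵘ → Set
AtMostPower r k s = cleared (↥ s)
  where
  aᵈ = ∣ ↥ r ∣ ℕ.^ ↧ₙ s
  bᵈ = ↧ₙ r ℕ.^ ↧ₙ s

  cleared : ℤ → Set
  cleared (+ c)    = aᵈ ℕ.* k ℕ.^ c ℕ.≤ bᵈ
  cleared -[1+ c ] = aᵈ ℕ.≤ bᵈ ℕ.* k ℕ.^ suc c

infix 8 _^-_

-- Only meaningful as a power for k ≥ 1.
_^-_ : ℕ → ℚᵘ → LowerReal 0ℓ
k ^- s = sup λ r → 0ℚᵘ ≤ r × AtMostPower r k s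

-- For e = c / d ≥ 0, the inequality m ≥ n ^ e is n ^ c ≤ m ^ d.
AtLeastPower : ℕ → ℕ → ℚᵘ → Set
AtLeastPower m n e = n ℕ.^ ∣ ↥ e ∣ ℕ.≤ m ℕ.^ ↧ₙ e

EHExponent : ∀ {h} → Tournament h → ℚᵘ → Set₁
EHExponent H e =
  0ℚᵘ ≤ e ×
  (∀ n → 1 ℕ.≤ n → (T : Tournament n) → H -Free T →
    Σ ℕ λ m → Σ (Fin m ↣ Fin n) λ f → Transitive (induced T f) ×
      AtLeastPower m n e)

-- The real exponents e ≥ 0 with this property form an interval containing 0
-- (as n ≥ 1), so the supremum over the rational ones is the same.
ε : ∀ {h} → Tournament h → LowerReal (lsuc 0ℓ)
ε H = sup (EHExponent H)

{-# OPTIONS --safe #-}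
-- Lower bound.  Let T have no path P k.  A greedy search for a path
-- v₁, v₂, … can only be blocked by two large sets one of which sends almost all
-- edges to the other, and iterating this log k times gives over 2k large sets
-- A₁, A₂, … with almost all edges going from earlier to later sets.  In the
-- order v₂ v₁ v₄ v₃ v₆ v₅ … the backward edges of a path form a matching, so if
-- large subsets of every Aᵢ and Aⱼ spanned a backward edge, a path could be
-- embedded.  Hence some two sets of size at least n / 2 ^ L are joined
-- completely in one direction, where L = O(k log² k), and recursion inside both
-- of them gives a transitive subtournament of size about n ^ (1 / L).
--
-- Upper bound.  By a union bound some tournament on 2 ^ (k / 4) vertices has
-- neither a path P k nor a transitive subtournament on k vertices.
module Submission where

open import Defs

-- The count k log² k arises as follows. Each of the k greedy steps may shrink the pool by a factor
-- polynomial in k, so a sparse pair costs about k log k in the exponent, and about log k rounds of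
-- splitting are needed to reach more than 2k parts. The sparsity has to be about 1/(2k), because
-- restricting the later parts to the out-neighbourhoods of the chosen vertices weakens it at every
-- choice.
--
-- The obstacle is a mismatch of sides. A sparse pair bounds the edges sent back by each vertex of
-- the later set, whereas the embedding needs, for each vertex of an earlier part, a bound relative
-- to every later part separately. Averaging turns one into the other after some vertices of the
-- earlier set are deleted; this requires the sparsity to be stronger by a factor of twice the
-- number of parts, still polynomial in k.
--
-- Logarithms and roots are avoided by placing k between 2 ^ x and 2 ^ (x + 1) and measuring sizes
-- by powers of two. All polylogarithmic factors are then powers of 16 x, and a fixed power of 16 x
-- is at most 2 ^ x, hence at most k, once x is large; this is how they disappear into k ^ δ.

module Coefficients where

  open import Data.Bool.Base using (Bool; true; false; not)
  open import Data.Empty using (⊥-elim)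
  open import Data.Fin.Base as Fin using (Fin; zero; suc; fromℕ; inject₁; inject≤; combine)
  import Data.Fin.Properties as Fin
  open import Data.Integer.Base as ℤ using (-[1+_]; ∣_∣; _⊖_; +≤+)
  import Data.Integer.Properties as ℤ
  open import Data.List.Base as List using (List; []; _∷_; length; filter; map; take; drop; _++_; allFin; tabulate; cartesianProductWith)
  open import Data.List.Membership.Propositional using (_∈_; find; lose)
  open import Data.List.Membership.Propositional.Properties using (∈-filter⁻; ∈-filter⁺; ∈-lookup; ∈-map⁺; ∈-++⁺ˡ; ∈-++⁺ʳ; ∈-cartesianProductWith⁺; ∈-allFin)
  open import Data.List.Properties using (length-++; length-map; length-take; length-drop; length-tabulate; length-filter; map-∘; map-++)
  open import Data.List.Relation.Binary.Sublist.Propositional using (_⊆_; []; _∷_; _∷ʳ_; lookup; ⊆-refl; ⊆-trans)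
  open import Data.List.Relation.Binary.Sublist.Propositional.Properties using (filter-⊆; take-⊆; drop-⊆; All-resp-⊆)
  open import Data.List.Relation.Unary.All as All using (All; []; _∷_)
  import Data.List.Relation.Unary.All.Properties as All
  open import Data.List.Relation.Unary.AllPairs as AllPairs using (AllPairs; []; _∷_)
  import Data.List.Relation.Unary.AllPairs.Properties as AllPairs
  open import Data.List.Relation.Unary.Any using (Any; here; there; any?)
  open import Data.List.Relation.Unary.Unique.DecPropositional using (unique?)
  open import Data.List.Relation.Unary.Unique.Propositional using (Unique)
  open import Data.List.Relation.Unary.Unique.Propositional.Properties using (allFin⁺)
  open import Data.Nat.Base
  open import Data.Nat.DivMod using (_/_; _%_; m≡m%n+[m/n]*n; m%n<n; m/n*n≤m)
  open import Data.Nat.ListAction using (sum)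
  open import Data.Nat.Properties
  open import Data.Nat.Tactic.RingSolver using (solve-∀)
  open import Data.Product.Base using (Σ; ∃; _×_; _,_; proj₁; proj₂)
  open import Data.Rational.Unnormalised.Base as ℚ using (mkℚᵘ; 0ℚᵘ; 1ℚᵘ; ↥_; ↧ₙ_; *≤*)
  import Data.Rational.Unnormalised.Properties as ℚ
  open import Data.Sum.Base using (_⊎_; inj₁; inj₂; map₂; swap)
  open import Data.Unit.Base using (⊤; tt)
  open import Data.Vec.Base as Vec using (Vec; []; _∷_; updateAt)
  open import Data.Vec.Properties using (lookup∘updateAt; lookup∘updateAt′)
  open import Function.Base using (_∘_; _on_)
  open import Function.Bundles using (_↣_; mk↣; mk⇔; Injection; Inverse; Equivalence)
  open import Function.Construct.Identity using (↔-id)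
  open import Function.Definitions using (Injective)
  open import Level using (Level)
  open import Relation.Binary.Core using (Rel)
  open import Relation.Binary.Definitions using (tri<; tri≈; tri>)
  open import Relation.Binary.PropositionalEquality using (_≡_; _≢_; refl; sym; trans; cong; cong₂; subst; subst₂; setoid; ≢-sym; module ≡-Reasoning)
  open import Relation.Nullary using (¬_; Dec; yes; no; _×-dec_)
  open import Relation.Unary using (Pred; Decidable)

  -- Counting in lists and averaging

  private variable
    ℓ₁ ℓ₂ ℓ₃ ℓ₄ : Level
    X : Set ℓ₁
    Y : Set ℓ₂

  Σ[_] : List X → (X → ℕ) → ℕ
  Σ[ xs ] f = sum (map f xs)

  count : {P : Pred X ℓ₃} → Decidable P → List X → ℕ
  count P? xs = length (filter P? xs)

  count-mono : {P : Pred X ℓ₃} {Q : Pred X ℓ₄} (P? : Decidable P) (Q? : Decidable Q) →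
               (∀ {x} → P x → Q x) → ∀ xs → count P? xs ≤ count Q? xs
  count-mono P? Q? P⇒Q []       = z≤n
  count-mono P? Q? P⇒Q (x ∷ xs) with P? x | Q? x
  ... | yes _ | yes _ = s≤s (count-mono P? Q? P⇒Q xs)
  ... | yes p | no ¬q = ⊥-elim (¬q (P⇒Q p))
  ... | no  _ | yes _ = m≤n⇒m≤1+n (count-mono P? Q? P⇒Q xs)
  ... | no  _ | no  _ = count-mono P? Q? P⇒Q xs

  count-⊆ : {P : Pred X ℓ₃} (P? : Decidable P) {xs ys : List X} → xs ⊆ ys →
            count P? xs ≤ count P? ys
  count-⊆ P? []           = z≤n
  count-⊆ P? (y ∷ʳ s) with P? y
  ... | yes _ = m≤n⇒m≤1+n (count-⊆ P? s)
  ... | no  _ = count-⊆ P? s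
  count-⊆ P? (_∷_ {x} refl s) with P? x
  ... | yes _ = s≤s (count-⊆ P? s)
  ... | no  _ = count-⊆ P? s

  count-cover : {P : Pred X ℓ₃} {Q : Pred X ℓ₄} (P? : Decidable P) (Q? : Decidable Q) →
                ∀ xs → (∀ {x} → x ∈ xs → ¬ P x → Q x) →
                length xs ≤ count P? xs + count Q? xs
  count-cover P? Q? []       cov = z≤n
  count-cover P? Q? (x ∷ xs) cov with P? x | Q? x | count-cover P? Q? xs (cov ∘ there)
  ... | yes _ | yes _ | ih = s≤s (≤-trans ih (+-monoʳ-≤ _ (n≤1+n _)))
  ... | yes _ | no  _ | ih = s≤s ih
  ... | no  _ | yes _ | ih = ≤-trans (s≤s ih) (≤-reflexive (sym (+-suc _ _)))
  ... | no ¬p | no ¬q | _  = ⊥-elim (¬q (cov (here refl) ¬p))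

  AllPairs-resp-⊆ : {R : Rel X ℓ₄} {xs ys : List X} → xs ⊆ ys → AllPairs R ys → AllPairs R xs
  AllPairs-resp-⊆ []         []         = []
  AllPairs-resp-⊆ (_ ∷ʳ s)   (_ ∷ ps)   = AllPairs-resp-⊆ s ps
  AllPairs-resp-⊆ (refl ∷ s) (px ∷ ps)  = All-resp-⊆ s px ∷ AllPairs-resp-⊆ s ps

  Σ-+ : (f g : X → ℕ) → ∀ xs → Σ[ xs ] (λ x → f x + g x) ≡ Σ[ xs ] f + Σ[ xs ] g
  Σ-+ f g []       = refl
  Σ-+ f g (x ∷ xs) rewrite Σ-+ f g xs = lemma (f x) (g x) (Σ[ xs ] f) (Σ[ xs ] g)
    where
    lemma : ∀ u v w z → u + v + (w + z) ≡ u + w + (v + z)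
    lemma = solve-∀

  module _ {R : X → Y → Set ℓ₄} (R? : ∀ x y → Dec (R x y)) where

    private
      indicator : {P : Set ℓ₄} → Dec P → ℕ
      indicator (yes _) = 1
      indicator (no _)  = 0

      count≡Σ : ∀ x ys → count (R? x) ys ≡ Σ[ ys ] (λ y → indicator (R? x y))
      count≡Σ x [] = refl
      count≡Σ x (y ∷ ys) with R? x y
      ... | yes _ = cong suc (count≡Σ x ys)
      ... | no  _ = count≡Σ x ys

      count-∷ : ∀ x xs y → count (λ z → R? z y) (x ∷ xs) ≡ indicator (R? x y) + count (λ z → R? z y) xs
      count-∷ x xs y with R? x y
      ... | yes _ = refl
      ... | no  _ = refl

      Σ-cong : {f g : Y → ℕ} → (∀ y → f y ≡ g y) → ∀ ys → Σ[ ys ] f ≡ Σ[ ys ] g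
      Σ-cong f≡g []       = refl
      Σ-cong f≡g (y ∷ ys) = cong₂ _+_ (f≡g y) (Σ-cong f≡g ys)

      Σ-0 : ∀ (ys : List Y) → Σ[ ys ] (λ _ → 0) ≡ 0
      Σ-0 []       = refl
      Σ-0 (_ ∷ ys) = Σ-0 ys

    double-counting : ∀ xs ys → Σ[ xs ] (λ x → count (R? x) ys) ≡ Σ[ ys ] (λ y → count (λ x → R? x y) xs)
    double-counting []       ys = sym (Σ-0 ys)
    double-counting (x ∷ xs) ys = begin
      count (R? x) ys + Σ[ xs ] (λ x → count (R? x) ys)
        ≡⟨ cong₂ _+_ (count≡Σ x ys) (double-counting xs ys) ⟩
      Σ[ ys ] (λ y → indicator (R? x y)) + Σ[ ys ] (λ y → count (λ x → R? x y) xs)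
        ≡⟨ Σ-+ _ _ ys ⟨
      Σ[ ys ] (λ y → indicator (R? x y) + count (λ x → R? x y) xs)
        ≡⟨ Σ-cong (λ y → sym (count-∷ x xs y)) ys ⟩
      Σ[ ys ] (λ y → count (λ x → R? x y) (x ∷ xs)) ∎
      where open ≡-Reasoning

    -- The related pairs are counted twice: the rows allow at most a share 1/`q` of all pairs, and
    -- every column in `P?` takes up at least a share 1/`p` of `xs`. Every passage from a bound for
    -- all vertices of one side to a bound for most vertices of the other goes through this.
    markov : ∀ p q xs ys → 1 ≤ length xs →
             (∀ {x} → x ∈ xs → q * count (R? x) ys ≤ length ys) →
             {P : Pred Y ℓ₃} (P? : Decidable P) →
             (∀ {y} → P y → length xs ≤ p * count (λ x → R? x y) xs) →
             q * count P? ys ≤ p * length ys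
    markov p q xs ys 1≤ light P? heavy =
      *-cancelʳ-≤ _ _ (length xs) ⦃ >-nonZero 1≤ ⦄ (begin
        q * count P? ys * length xs        ≡⟨ *-assoc q _ _ ⟩
        q * (count P? ys * length xs)      ≤⟨ *-monoʳ-≤ q (below ys) ⟩
        q * (p * Σ[ ys ] col)              ≡⟨ cong (λ z → q * (p * z)) (double-counting xs ys) ⟨
        q * (p * Σ[ xs ] row)              ≡⟨ lemma₁ q p _ ⟩
        p * (q * Σ[ xs ] row)              ≤⟨ *-monoʳ-≤ p (above xs light) ⟩
        p * (length xs * length ys)        ≡⟨ lemma₂ p (length xs) (length ys) ⟩
        p * length ys * length xs          ∎)
      where
      open ≤-Reasoning
      col = λ y → count (λ x → R? x y) xs
      row = λ x → count (R? x) ys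

      lemma₁ : ∀ q p z → q * (p * z) ≡ p * (q * z)
      lemma₁ = solve-∀
      lemma₂ : ∀ p x y → p * (x * y) ≡ p * y * x
      lemma₂ = solve-∀

      below : ∀ zs → count P? zs * length xs ≤ p * Σ[ zs ] col
      below []       = z≤n
      below (z ∷ zs) with P? z
      ... | yes Pz = ≤-trans (+-mono-≤ (heavy Pz) (below zs)) (≤-reflexive (sym (*-distribˡ-+ p _ _)))
      ... | no  _  = ≤-trans (below zs) (*-monoʳ-≤ p (m≤n+m _ (col z)))

      above : ∀ zs → (∀ {x} → x ∈ zs → q * row x ≤ length ys) → q * Σ[ zs ] row ≤ length zs * length ys
      above []       _ = ≤-reflexive (*-zeroʳ q)
      above (z ∷ zs) h = ≤-trans (≤-reflexive (*-distribˡ-+ q _ _)) (+-mono-≤ (h (here refl)) (above zs (h ∘ there)))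

  -- Paths and sparse pairs

  half : ∀ {s x y} → 2 * s ≤ x + y → s ≤ x ⊎ s ≤ y
  half {s} {x} {y} h with s ≤? x | s ≤? y
  ... | yes s≤x | _       = inj₁ s≤x
  ... | no  _   | yes s≤y = inj₂ s≤y
  ... | no  s≰x | no s≰y  = ⊥-elim (<⇒≱ (+-mono-< (≰⇒> s≰x) (≰⇒> s≰y))
                                     (≤-trans (≤-reflexive (cong (s +_) (sym (+-identityʳ s)))) h))

  nonempty : ∀ {A : Set} {xs : List A} → 1 ≤ length xs → ∃ (_∈ xs)
  nonempty {xs = x ∷ _} _ = x , here refl

  take-drop-disjoint : ∀ {A : Set} m {xs : List A} → Unique xs →
                       ∀ {x y} → x ∈ take m xs → y ∈ drop m xs → x ≢ y
  take-drop-disjoint (suc m) {z ∷ zs} (z∉ ∷ _) (here refl) y∈ = All.lookup z∉ (lookup (drop-⊆ m zs) y∈)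
  take-drop-disjoint (suc m) {z ∷ zs} (_ ∷ u)  (there x∈)  y∈ = take-drop-disjoint m u x∈ y∈

  -- The factor in size paid for doubling the number of parts: `4 * (2 * q₀) ^ k` buys a sparse pair
  -- with `q₀ = q * (2 * m)`, and the outer 2 makes up for cleaning, which may discard half of the
  -- earlier side.
  loss : ℕ → ℕ → ℕ → ℕ
  loss k q m = 2 * (4 * (2 * (q * (2 * m))) ^ k)

  module _ {n} (T : Tournament n) where

    private
      V = Fin n
      E = Edge T

    edge? : ∀ u v → Dec (E u v)
    edge? u v with u Fin.≟ v
    ... | yes refl = no (Tournament.irrefl T u)
    ... | no u≢v with Tournament.exactlyOne T u v u≢v
    ...   | inj₁ (e , _)  = yes e
    ...   | inj₂ (_ , ¬e) = no ¬e

    edge-asym : ∀ {u v} → E u v → ¬ E v u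
    edge-asym {u} {v} e e′ with u Fin.≟ v
    ... | yes refl = Tournament.irrefl T u e
    ... | no u≢v with Tournament.exactlyOne T u v u≢v
    ...   | inj₁ (_ , ¬e′) = ¬e′ e′
    ...   | inj₂ (_ , ¬e)  = ¬e e

    edge-total : ∀ {u v} → u ≢ v → ¬ E u v → E v u
    edge-total {u} {v} u≢v ¬e with Tournament.exactlyOne T u v u≢v
    ... | inj₁ (e , _)  = ⊥-elim (¬e e)
    ... | inj₂ (e′ , _) = e′

    IsPath : List V → Set
    IsPath []           = ⊤
    IsPath (_ ∷ [])     = ⊤
    IsPath (v ∷ w ∷ vs) = E w v × All (E v) vs × IsPath (w ∷ vs)

    Disjoint : List V → List V → Set
    Disjoint A B = ∀ {a b} → a ∈ A → b ∈ B → a ≢ b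

    -- i does not count the first vertex.
    record PathIn (i : ℕ) (Y : List V) (X : V → Set) : Set where
      constructor pathIn
      field
        head   : V
        tail   : List V
        head∈  : head ∈ Y
        tail∈  : All X tail
        isPath : IsPath (head ∷ tail)
        len    : length tail ≡ i

    outDeg inDeg : V → List V → ℕ
    outDeg v A = count (edge? v) A
    inDeg v A = count (λ a → edge? a v) A

    record SparsePair (q s : ℕ) (Z : List V) : Set where
      constructor sparsePair
      field
        A B      : List V
        A⊆       : A ⊆ Z
        B⊆       : B ⊆ Z
        disjoint : Disjoint A B
        ∣A∣      : s ≤ length A
        ∣B∣      : s ≤ length B
        sparse   : ∀ {b} → b ∈ B → q * outDeg b A ≤ length A

    record CompletePair (s : ℕ) (Z : List V) : Set where
      constructor completePair
      field
        A B      : List V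
        A⊆       : A ⊆ Z
        B⊆       : B ⊆ Z
        ∣A∣      : s ≤ length A
        ∣B∣      : s ≤ length B
        complete : ∀ {a b} → a ∈ A → b ∈ B → E a b

    -- Vertices are chosen greedily; the next one comes from Y and all later ones
    -- from X.  The step is blocked only if every y ∈ Y has few in-neighbours or
    -- few out-neighbours in X.
    grow : ∀ q s → 1 ≤ q → 1 ≤ s → ∀ {Z} i Y X → Y ⊆ Z → X ⊆ Z → Disjoint Y X →
           2 * s ≤ length Y → 2 * s * (2 * q) ^ i ≤ length X →
           PathIn i Y (_∈ X) ⊎ SparsePair q s Z
    grow q s 1≤q 1≤s zero Y X Y⊆ X⊆ Y#X ∣Y∣ ∣X∣ =
      let y , y∈ = nonempty (≤-trans (≤-trans 1≤s (m≤m+n s _)) ∣Y∣)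
      in inj₁ (pathIn y [] y∈ [] tt refl)
    grow q s 1≤q 1≤s {Z} (suc i) Y X Y⊆ X⊆ Y#X ∣Y∣ ∣X∣
      with any? (λ y → (2 * s ≤? inDeg y X) ×-dec (2 * s * (2 * q) ^ i ≤? outDeg y X)) Y
    ... | yes found = continue (find found)
      where
      continue : ∃ (λ y → y ∈ Y × (2 * s ≤ inDeg y X) × (2 * s * (2 * q) ^ i ≤ outDeg y X)) →
                 PathIn (suc i) Y (_∈ X) ⊎ SparsePair q s Z
      continue (y , y∈ , ins , outs)
        with grow q s 1≤q 1≤s i (filter (λ x → edge? x y) X) (filter (edge? y) X)
               (⊆-trans (filter-⊆ _ X) X⊆) (⊆-trans (filter-⊆ _ X) X⊆)
               (λ a∈ b∈ → λ { refl → edge-asym (proj₂ (∈-filter⁻ (λ x → edge? x y) {xs = X} a∈))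
                                              (proj₂ (∈-filter⁻ (edge? y) {xs = X} b∈)) })
               ins outs
      ... | inj₂ sp = inj₂ sp
      ... | inj₁ (pathIn h tl h∈ tl∈ path len) =
        let h∈X , h→y = ∈-filter⁻ (λ x → edge? x y) {xs = X} h∈
        in inj₁ (pathIn y (h ∷ tl) y∈
                   (h∈X ∷ All.map (proj₁ ∘ ∈-filter⁻ (edge? y) {xs = X}) tl∈)
                   (h→y , All.map (proj₂ ∘ ∈-filter⁻ (edge? y) {xs = X}) tl∈ , path)
                   (cong suc len))
    ... | no blocked = inj₂ sparse
      where
      open ≤-Reasoning
      fewIn? = λ y → 2 * q * inDeg y X ≤? length X
      fewOut? = λ y → 2 * q * outDeg y X ≤? length X
      Yᵢ = filter fewIn? Y
      Yₒ = filter fewOut? Y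

      1≤2q^ : ∀ j → 1 ≤ (2 * q) ^ j
      1≤2q^ j = m^n>0 (2 * q) ⦃ >-nonZero (≤-trans 1≤q (m≤m+n q _)) ⦄ j

      -- The assumption on `X` has one factor `2 * q` more than the next step asks for, so a degree
      -- that falls short is at most a share 1/(2 q) of `X`.
      small : ∀ {d} → d ≤ 2 * s * (2 * q) ^ i → 2 * q * d ≤ length X
      small {d} d≤ = begin
        2 * q * d                       ≤⟨ *-monoʳ-≤ (2 * q) d≤ ⟩
        2 * q * (2 * s * (2 * q) ^ i)   ≡⟨ lemma (2 * q) (2 * s) ((2 * q) ^ i) ⟩
        2 * s * (2 * q * (2 * q) ^ i)   ≤⟨ ∣X∣ ⟩
        length X                        ∎
        where
        lemma : ∀ u v w → u * (v * w) ≡ v * (u * w)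
        lemma = solve-∀

      dichotomy : ∀ {y} → y ∈ Y → ¬ (2 * q * inDeg y X ≤ length X) → 2 * q * outDeg y X ≤ length X
      dichotomy {y} y∈ ¬few with 2 * s * (2 * q) ^ i ≤? outDeg y X
      ... | no  few  = small (<⇒≤ (≰⇒> few))
      ... | yes outs with 2 * s ≤? inDeg y X
      ...   | yes ins = ⊥-elim (blocked (lose y∈ (ins , outs)))
      ...   | no  few = ⊥-elim (¬few (small (≤-trans (<⇒≤ (≰⇒> few)) (m≤m*n (2 * s) _ ⦃ >-nonZero (1≤2q^ i) ⦄))))

      2s≤∣X∣ : 2 * s ≤ length X
      2s≤∣X∣ = ≤-trans (m≤m*n (2 * s) _ ⦃ >-nonZero (1≤2q^ (suc i)) ⦄) ∣X∣

      sparse : SparsePair q s Z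
      sparse with half {s} (≤-trans ∣Y∣ (count-cover fewIn? fewOut? Y dichotomy))
      ... | inj₂ s≤ = sparsePair X Yₒ X⊆ (⊆-trans (filter-⊆ _ Y) Y⊆)
            (λ a∈ b∈ a≡b → Y#X (proj₁ (∈-filter⁻ fewOut? b∈)) a∈ (sym a≡b))
            (≤-trans (m≤m+n s _) 2s≤∣X∣) s≤
            (λ {b} b∈ → ≤-trans (*-monoˡ-≤ (outDeg b X) (m≤m+n q _)) (proj₂ (∈-filter⁻ fewOut? {xs = Y} b∈)))
      -- Here the bound is on the wrong side: it limits the in-neighbours in `X` of each vertex of
      -- `Yᵢ`, while a bound for each vertex of `X` is wanted. Averaging shows that at most half of
      -- `X` is `heavy?`; the 2 in `2 * q` pays for this.
      ... | inj₁ s≤ = sparsePair Yᵢ X′ (⊆-trans (filter-⊆ _ Y) Y⊆) (⊆-trans (filter-⊆ _ X) X⊆)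
            (λ a∈ b∈ → Y#X (proj₁ (∈-filter⁻ fewIn? a∈)) (proj₁ (∈-filter⁻ light? b∈)))
            s≤ s≤X′
            (λ b∈ → proj₂ (∈-filter⁻ light? {xs = X} b∈))
        where
        light? = λ x → q * outDeg x Yᵢ ≤? length Yᵢ
        heavy? = λ x → length Yᵢ ≤? q * outDeg x Yᵢ
        X′ = filter light? X
        2heavy : 2 * count heavy? X ≤ length X
        2heavy = *-cancelˡ-≤ q ⦃ >-nonZero 1≤q ⦄ (begin
          q * (2 * count heavy? X) ≡⟨ lemma q _ ⟩
          2 * q * count heavy? X   ≤⟨ markov (λ y x → edge? x y) q (2 * q) Yᵢ X (≤-trans 1≤s s≤)
                                        (λ y∈ → proj₂ (∈-filter⁻ fewIn? {xs = Y} y∈)) heavy? (λ h → h) ⟩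
          q * length X             ∎)
          where
          lemma : ∀ q z → q * (2 * z) ≡ 2 * q * z
          lemma = solve-∀
        s≤X′ : s ≤ length X′
        s≤X′ = *-cancelˡ-≤ 2 (+-cancelʳ-≤ (length X) _ _ (begin
          2 * s + length X                          ≤⟨ +-monoˡ-≤ (length X) 2s≤∣X∣ ⟩
          length X + length X                       ≤⟨ +-mono-≤ cov cov ⟩
          (length X′ + h) + (length X′ + h)         ≡⟨ lemma (length X′) h ⟩
          2 * length X′ + 2 * h                     ≤⟨ +-monoʳ-≤ (2 * length X′) 2heavy ⟩
          2 * length X′ + length X                  ∎))
          where
          h = count heavy? X
          cov = count-cover light? heavy? X (λ _ ¬l → <⇒≤ (≰⇒> ¬l))
          lemma : ∀ u v → (u + v) + (u + v) ≡ 2 * u + 2 * v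
          lemma = solve-∀

    path-or-sparse : ∀ q s k Z → 1 ≤ q → 1 ≤ s → Unique Z → s * (4 * (2 * q) ^ k) ≤ length Z →
                     ∃ (λ vs → IsPath vs × length vs ≡ suc k) ⊎ SparsePair q s Z
    path-or-sparse q s k Z 1≤q 1≤s uniq ∣Z∣
      with grow q s 1≤q 1≤s k (take m Z) (drop m Z) (take-⊆ m Z) (drop-⊆ m Z)
             (take-drop-disjoint m uniq) 2s≤ ≤drop
      where
      open ≤-Reasoning
      m = 2 * s * (2 * q) ^ k
      2m≤ : m + m ≤ length Z
      2m≤ = ≤-trans (≤-reflexive (lemma s ((2 * q) ^ k))) ∣Z∣
        where
        lemma : ∀ s t → 2 * s * t + 2 * s * t ≡ s * (4 * t)
        lemma = solve-∀
      2s≤ : 2 * s ≤ length (take m Z)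
      2s≤ = begin
        2 * s                ≤⟨ m≤m*n (2 * s) _ ⦃ m^n≢0 (2 * q) k ⦃ >-nonZero (≤-trans 1≤q (m≤m+n q _)) ⦄ ⦄ ⟩
        m                    ≤⟨ ⊓-glb ≤-refl (m+n≤o⇒m≤o m 2m≤) ⟩
        m ⊓ length Z         ≡⟨ length-take m Z ⟨
        length (take m Z)    ∎
      ≤drop : m ≤ length (drop m Z)
      ≤drop = ≤-trans (m+n≤o⇒m≤o∸n m 2m≤) (≤-reflexive (sym (length-drop m Z)))
    ... | inj₁ (pathIn h tl _ _ path len) = inj₁ (h ∷ tl , path , cong suc len)
    ... | inj₂ sp = inj₂ sp

    -- Families of parts with few backward edges

    -- The bound is for each vertex of the earlier set, relative to the size of the later one. It
    -- therefore survives any shrinking of `A`, whereas shrinking `B` has to be paid for in `q`.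
    Forward : ℕ → List V → List V → Set
    Forward q A B = Disjoint A B × (∀ {a} → a ∈ A → q * inDeg a B ≤ length B)

    Forward-⊆ : ∀ {q A A′ B} → A′ ⊆ A → Forward q A B → Forward q A′ B
    Forward-⊆ A′⊆ (A#B , few) = (λ a∈ → A#B (lookup A′⊆ a∈)) , (λ a∈ → few (lookup A′⊆ a∈))

    -- For a single `B`, averaging shows that at most a share 1/`t` of `A` receives many edges from
    -- it; these vertices are deleted for every `B` in turn. Heavy vertices are always counted in
    -- the whole of `A`, so the losses simply add up.
    clean : ∀ q t A Bs → 1 ≤ q →
            All (λ B → 1 ≤ length B × (∀ {b} → b ∈ B → q * t * outDeg b A ≤ length A)) Bs →
            ∃ λ A′ → A′ ⊆ A × (∀ {a} → a ∈ A′ → All (λ B → q * inDeg a B ≤ length B) Bs) ×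
                     t * length A ≤ t * length A′ + length Bs * length A
    clean q t A []       1≤q []               = A , ⊆-refl , (λ _ → []) , m≤m+n _ _
    clean q t A (B ∷ Bs) 1≤q ((1≤B , few) ∷ hs) with clean q t A Bs 1≤q hs
    ... | A₁ , A₁⊆ , light , ∣A₁∣ = filter light? A₁ , ⊆-trans (filter-⊆ _ A₁) A₁⊆ , light′ , (begin
        t * length A
          ≤⟨ ∣A₁∣ ⟩
        t * length A₁ + length Bs * length A
          ≤⟨ +-monoˡ-≤ _ (*-monoʳ-≤ t (count-cover light? heavy? A₁ (λ _ ¬l → <⇒≤ (≰⇒> ¬l)))) ⟩
        t * (count light? A₁ + count heavy? A₁) + length Bs * length A
          ≤⟨ +-monoˡ-≤ _ (*-monoʳ-≤ t (+-monoʳ-≤ (count light? A₁) (count-⊆ heavy? A₁⊆))) ⟩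
        t * (count light? A₁ + count heavy? A) + length Bs * length A
          ≡⟨ lemma t (count light? A₁) (count heavy? A) (length Bs * length A) ⟩
        t * count light? A₁ + (t * count heavy? A + length Bs * length A)
          ≤⟨ +-monoʳ-≤ (t * count light? A₁) (+-monoˡ-≤ (length Bs * length A) fewHeavy) ⟩
        t * count light? A₁ + (length A + length Bs * length A) ∎)
      where
      open ≤-Reasoning
      light? = λ a → q * inDeg a B ≤? length B
      heavy? = λ a → length B ≤? q * inDeg a B
      light′ : ∀ {a} → a ∈ filter light? A₁ → All (λ B → q * inDeg a B ≤ length B) (B ∷ Bs)
      light′ a∈ = let a∈₁ , l = ∈-filter⁻ light? {xs = A₁} a∈ in l ∷ light a∈₁
      lemma : ∀ t x y z → t * (x + y) + z ≡ t * x + (t * y + z)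
      lemma = solve-∀
      fewHeavy : t * count heavy? A ≤ length A
      fewHeavy = *-cancelˡ-≤ q ⦃ >-nonZero 1≤q ⦄ (≤-trans (≤-reflexive (sym (*-assoc q t _)))
                   (markov edge? q (q * t) B A 1≤B few heavy? (λ h → h)))

    record Parts (q s ℓ : ℕ) (Z : List V) : Set where
      constructor mkParts
      field
        parts   : List (List V)
        number  : length parts ≡ 2 ^ ℓ
        forward : AllPairs (Forward q) parts
        sizes   : All (λ C → s ≤ length C) parts
        parts⊆  : All (_⊆ Z) parts

    Parts-++ : ∀ {q s ℓ A B Z} → A ⊆ Z → B ⊆ Z → Disjoint A B → (partsB : Parts q s ℓ B) →
               (∀ {a} → a ∈ A → All (λ C → q * inDeg a C ≤ length C) (Parts.parts partsB)) →
               Parts q s ℓ A → Parts q s (suc ℓ) Z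
    Parts-++ {q} A⊆ B⊆ A#B (mkParts Bs #B forwardB sizesB Bs⊆) light (mkParts As #A forwardA sizesA As⊆) =
      mkParts (As ++ Bs)
        (trans (length-++ As) (cong₂ _+_ #A (trans #B (sym (+-identityʳ _)))))
        (AllPairs.++⁺ forwardA forwardB (All.map across As⊆))
        (All.++⁺ sizesA sizesB)
        (All.++⁺ (All.map (λ C⊆ → ⊆-trans C⊆ A⊆) As⊆) (All.map (λ C⊆ → ⊆-trans C⊆ B⊆) Bs⊆))
      where
      across : ∀ {C} → C ⊆ _ → All (Forward q C) Bs
      across C⊆ = All.tabulate (λ D∈ →
        (λ a∈ b∈ → A#B (lookup C⊆ a∈) (lookup (All.lookup Bs⊆ D∈) b∈)) ,
        (λ a∈ → All.lookup (light (lookup C⊆ a∈)) D∈))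

    module _ (k q m : ℕ) (1≤q : 1 ≤ q) (1≤m : 1 ≤ m) where

      private
        q₀ = q * (2 * m)
        Γ = loss k q m
        1≤q₀ : 1 ≤ q₀
        1≤q₀ = *-mono-≤ 1≤q (*-mono-≤ {1} {2} (s≤s z≤n) 1≤m)
        1≤Γ : 1 ≤ Γ
        1≤Γ = *-mono-≤ {1} {2} (s≤s z≤n) (*-mono-≤ {1} {4} (s≤s z≤n)
                   (m^n>0 (2 * q₀) ⦃ >-nonZero (*-mono-≤ {1} {2} (s≤s z≤n) 1≤q₀) ⦄ k))

      private
        halved : ∀ {b x y} → b ≤ m → 2 * m * x ≤ 2 * m * y + b * x → x ≤ 2 * y
        halved {b} {x} {y} b≤m h = *-cancelˡ-≤ m ⦃ >-nonZero 1≤m ⦄ (+-cancelʳ-≤ (m * x) _ _ (begin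
          m * x + m * x          ≡⟨ lemma₁ m x ⟩
          2 * m * x              ≤⟨ h ⟩
          2 * m * y + b * x      ≤⟨ +-mono-≤ (≤-reflexive (lemma₂ m y)) (*-monoˡ-≤ x b≤m) ⟩
          m * (2 * y) + m * x    ∎))
          where
          open ≤-Reasoning
          lemma₁ : ∀ m x → m * x + m * x ≡ 2 * m * x
          lemma₁ = solve-∀
          lemma₂ : ∀ m x → 2 * m * x ≡ m * (2 * x)
          lemma₂ = solve-∀

      -- Splitting the later side B before A is cleaned keeps the bound: it is
      -- stated for each vertex of B, hence survives passing to subsets of B.
      path-or-parts : ∀ ℓ s Z → 2 ^ ℓ ≤ m → 1 ≤ s → Unique Z → s * Γ ^ ℓ ≤ length Z →
                      ∃ (λ vs → IsPath vs × length vs ≡ suc k) ⊎ Parts q s ℓ Z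
      path-or-parts zero s Z _ 1≤s uniq ∣Z∣ =
        inj₂ (mkParts (Z ∷ []) refl ([] ∷ []) (≤-trans (≤-reflexive (sym (*-identityʳ s))) ∣Z∣ ∷ []) (⊆-refl ∷ []))
      path-or-parts (suc ℓ) s Z 2^≤m 1≤s uniq ∣Z∣ =
        fromSparse (path-or-sparse q₀ (2 * (s * Γ ^ ℓ)) k Z 1≤q₀ 1≤2s′ uniq
                     (≤-trans (≤-reflexive (lemma s (Γ ^ ℓ) ((2 * q₀) ^ k))) ∣Z∣))
        where
        lemma : ∀ s x y → 2 * (s * x) * (4 * y) ≡ s * (2 * (4 * y) * x)
        lemma = solve-∀
        1≤2s′ : 1 ≤ 2 * (s * Γ ^ ℓ)
        1≤2s′ = *-mono-≤ {1} {2} (s≤s z≤n) (*-mono-≤ 1≤s (m^n>0 Γ ⦃ >-nonZero 1≤Γ ⦄ ℓ))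
        2^ℓ≤m : 2 ^ ℓ ≤ m
        2^ℓ≤m = ≤-trans (m≤m+n _ _) 2^≤m

        Path = ∃ (λ vs → IsPath vs × length vs ≡ suc k)

        fromSparse : Path ⊎ SparsePair q₀ (2 * (s * Γ ^ ℓ)) Z → Path ⊎ Parts q s (suc ℓ) Z
        fromSparse (inj₁ path) = inj₁ path
        fromSparse (inj₂ (sparsePair A B A⊆ B⊆ A#B ∣A∣ ∣B∣ sparse)) =
          fromLater (path-or-parts ℓ s B 2^ℓ≤m 1≤s (AllPairs-resp-⊆ B⊆ uniq) (≤-trans (m≤m+n _ _) ∣B∣))
          where
          fromLater : Path ⊎ Parts q s ℓ B → Path ⊎ Parts q s (suc ℓ) Z
          fromLater (inj₁ path) = inj₁ path
          fromLater (inj₂ partsB@(mkParts Bs #B _ sizesB Bs⊆)) =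
            -- With `t = 2 * m` and at most `m` parts in `Bs`, cleaning discards at most half of
            -- `A`; `A` was requested twice as large for this reason.
            let A′ , A′⊆ , light , ∣A′∣ = clean q (2 * m) A Bs 1≤q
                  (All.zipWith (λ { (s≤ , C⊆) → ≤-trans 1≤s s≤ , (λ {_} b∈ → sparse (lookup C⊆ b∈)) }) (sizesB , Bs⊆))
            in map₂ (Parts-++ (⊆-trans A′⊆ A⊆) B⊆ (λ a∈ → A#B (lookup A′⊆ a∈)) partsB light)
                 (path-or-parts ℓ s A′ 2^ℓ≤m 1≤s (AllPairs-resp-⊆ (⊆-trans A′⊆ A⊆) uniq)
                   (*-cancelˡ-≤ 2 (≤-trans ∣A∣ (halved (≤-trans (≤-reflexive #B) 2^ℓ≤m) ∣A′∣))))

  -- Embedding a path into almost forward parts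

  -- A share 1/(q + 1) of a set becomes a share of at most 1/q once the set has lost a share 1/(q +
  -- 1) of itself. The same computation serves for degrees and, with `S` in the role of `x`, for
  -- sizes.
  scale : ∀ q x {y z} → suc q * x ≤ y → q * y ≤ suc q * z → q * x ≤ z
  scale q x {y} {z} x≤y y≤z = *-cancelˡ-≤ (suc q) (begin
    suc q * (q * x)   ≡⟨ lemma (suc q) q x ⟩
    q * (suc q * x)   ≤⟨ *-monoʳ-≤ q x≤y ⟩
    q * y             ≤⟨ y≤z ⟩
    suc q * z         ∎)
    where
    open ≤-Reasoning
    lemma : ∀ u v w → u * (v * w) ≡ v * (u * w)
    lemma = solve-∀

  module _ {n} (T : Tournament n) where

    private
      V = Fin n
      E = Edge T

    Light : ℕ → V → List V → Set
    Light q u C = (∀ {c} → c ∈ C → u ≢ c) × q * inDeg T u C ≤ length C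

    out : V → List V → List V
    out u = filter (edge? T u)

    ∣out∣ : ∀ q {u C} → Light (suc q) u C → q * length C ≤ suc q * length (out u C)
    ∣out∣ q {u} {C} (u∉ , few) = +-cancelˡ-≤ (length C) _ _ (begin
      suc q * length C
        ≤⟨ *-monoʳ-≤ (suc q) (count-cover (edge? T u) (λ c → edge? T c u) C (λ c∈ → edge-total T (u∉ c∈))) ⟩
      suc q * (length (out u C) + inDeg T u C)          ≡⟨ *-distribˡ-+ (suc q) (length (out u C)) _ ⟩
      suc q * length (out u C) + suc q * inDeg T u C    ≤⟨ +-monoʳ-≤ (suc q * length (out u C)) few ⟩
      suc q * length (out u C) + length C               ≡⟨ +-comm _ (length C) ⟩
      length C + suc q * length (out u C)               ∎)
      where open ≤-Reasoning

    -- Passing to the out-neighbourhood of a vertex with few in-neighbours in a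
    -- part costs one unit of q.
    Forward-out : ∀ q {u A C} → Light (suc q) u C → Forward T (suc q) A C → Forward T q A (out u C)
    Forward-out q {u} {A} {C} light (A#C , few) =
      (λ a∈ c∈ → A#C a∈ (lookup (filter-⊆ (edge? T u) C) c∈)) ,
      (λ {a} a∈ → ≤-trans (*-monoʳ-≤ q (count-⊆ (λ c → edge? T c a) (filter-⊆ (edge? T u) C)))
                          (scale q (inDeg T a C) (few a∈) (∣out∣ q light)))

    -- Nothing is measured against the size of `D`, the pool for the next vertex, so it may be cut
    -- down drastically; only `Cs` must stay large. Their lower bound `q * S` decreases in step with
    -- `q`, which keeps `S` fixed throughout the embedding.
    record Configuration (q S : ℕ) (Z D : List V) (Cs : List (List V)) : Set where
      constructor configuration
      field
        first   : All (Forward T q D) Cs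
        forward : AllPairs (Forward T q) Cs
        sizes   : All (λ C → q * S ≤ length C) Cs
        parts⊆  : All (_⊆ Z) Cs

    restrict : ∀ q S {Z D Cs} u → All (Light (suc q) u) Cs → Configuration (suc q) S Z D Cs →
               Configuration q S Z D (map (out u) Cs)
    restrict q S u [] (configuration [] [] [] []) = configuration [] [] [] []
    restrict q S {Cs = C ∷ Cs} u (l ∷ ls) (configuration (f ∷ fs) (p ∷ ps) (s ∷ ss) (z ∷ zs))
      with restrict q S {D = C} u ls (configuration p ps ss zs)
    ... | configuration fs′ ps′ ss′ zs′ = configuration
      (Forward-out q l f ∷ Configuration.first (restrict q S u ls (configuration fs ps ss zs)))
      (All.map (λ {B} → Forward-⊆ T {q} {B = B} (filter-⊆ (edge? T u) C)) fs′ ∷ ps′)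
      (scale q S s (∣out∣ q l) ∷ ss′)
      (⊆-trans (filter-⊆ _ C) z ∷ zs′)

    out-parts⁻ : ∀ u {x} Cs → Any (x ∈_) (map (out u) Cs) → E u x × Any (x ∈_) Cs
    out-parts⁻ u (C ∷ Cs) (here x∈)  = let x∈C , e = ∈-filter⁻ (edge? T u) {xs = C} x∈ in e , here x∈C
    out-parts⁻ u (C ∷ Cs) (there x∈) = let e , any = out-parts⁻ u Cs x∈ in e , there any

    Light-∈ : ∀ q {D u Cs} → u ∈ D → All (Forward T q D) Cs → All (Light q u) Cs
    Light-∈ q u∈ = All.map (λ { (D#C , few) → (λ {_} c∈ → D#C u∈ c∈) , few u∈ })

    -- In the order v₂ v₁ v₄ v₃ v₆ v₅ … the backward edges of a path are the
    -- disjoint pairs v₃v₂, v₅v₄, …; so one backward edge between every second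
    -- pair of parts suffices, and a missing one yields a complete pair.
    embed : ∀ t {r S Z} D Cs → 4 ≤ r → 1 ≤ S → t * 2 ≤ length Cs →
            D ⊆ Z → S ≤ length D → Configuration (t * 2 + r) S Z D Cs →
            PathIn T (t * 2) D (λ x → Any (x ∈_) Cs) ⊎ CompletePair T S Z
    embed zero D Cs 4≤r 1≤S _ D⊆ ∣D∣ _ =
      let d , d∈ = nonempty (≤-trans 1≤S ∣D∣) in inj₁ (pathIn d [] d∈ [] tt refl)
    embed (suc t) {r} {S} {Z} D (C ∷ C′ ∷ Cs) 4≤r 1≤S (s≤s (s≤s 2t≤)) D⊆ ∣D∣
      (configuration (fC ∷ fC′ ∷ fs) ((pC′ ∷ ps) ∷ ps′ ∷ pss) (sC ∷ sC′ ∷ ss) (C⊆ ∷ C′⊆ ∷ Cs⊆)) = result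
      where
      open ≤-Reasoning
      q₁ = suc (t * 2 + r)
      q = suc q₁
      4≤q : 4 ≤ q
      4≤q = ≤-trans 4≤r (m≤n+m r (suc (suc (t * 2))))
      4S≤ : ∀ {x} → q * S ≤ x → 4 * S ≤ x
      4S≤ = ≤-trans (*-monoˡ-≤ S 4≤q)
      -- A backward edge out of `w` helps only if many vertices of `C` point to `w`, as the next
      -- path vertex is sought among them. Most vertices of `C′` qualify because `C` is forward to
      -- `C′`.
      light? = λ w → 2 * outDeg T w C ≤? length C
      heavy? = λ w → length C ≤? 2 * outDeg T w C
      W = filter light? C′

      ∣W∣ : S ≤ length W
      ∣W∣ = *-cancelˡ-≤ 4 (+-cancelʳ-≤ (2 * length C′) _ _ (begin
        4 * S + 2 * length C′                       ≤⟨ +-monoˡ-≤ (2 * length C′) (4S≤ sC′) ⟩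
        length C′ + 2 * length C′                   ≤⟨ m≤m+n _ (length C′) ⟩
        length C′ + 2 * length C′ + length C′       ≡⟨ lemma₁ (length C′) ⟩
        4 * length C′                               ≤⟨ *-monoʳ-≤ 4 (count-cover light? heavy? C′ (λ _ ¬l → <⇒≤ (≰⇒> ¬l))) ⟩
        4 * (length W + count heavy? C′)            ≡⟨ *-distribˡ-+ 4 (length W) _ ⟩
        4 * length W + 4 * count heavy? C′          ≤⟨ +-monoʳ-≤ (4 * length W) (*-monoˡ-≤ (count heavy? C′) 4≤q) ⟩
        4 * length W + q * count heavy? C′          ≤⟨ +-monoʳ-≤ (4 * length W)
                                                         (markov (λ c w → edge? T w c) 2 q C C′
                                                           (≤-trans 1≤S (≤-trans (m≤m+n S _) (4S≤ sC)))
                                                           (proj₂ pC′) heavy? (λ h → h)) ⟩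
        4 * length W + 2 * length C′                ∎))
        where
        lemma₁ : ∀ x → x + 2 * x + x ≡ 4 * x
        lemma₁ = solve-∀

      -- The path continues with `u` in `D`, `w` in `C′` and then a vertex of `C`, the part lying
      -- between these two. Its edges from `u` and to `w` are forward, and `w` to `u` is the
      -- backward edge. Hence the new pool is a subset of `C`, and both `C` and `C′` leave the list.
      module Found {u} (u∈ : u ∈ D) {w} (w∈W : w ∈ W) (w→u : E w u) where
        w∈C′ : w ∈ C′
        w∈C′ = lookup (filter-⊆ light? C′) w∈W
        w-light : 2 * outDeg T w C ≤ length C
        w-light = proj₂ (∈-filter⁻ light? {xs = C′} w∈W)
        D₁ = out u C
        into? = λ c → edge? T c w
        D′ = filter into? D₁

        -- At most half of `C` is lost to out-neighbours of `w` and, as `4 ≤ q`, at most a quarter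
        -- to in-neighbours of `u`. A quarter of at least `4 * S` vertices remains; this is what
        -- `4 ≤ r` is for.
        ∣D′∣ : S ≤ length D′
        ∣D′∣ = *-cancelˡ-≤ 4 (+-cancelʳ-≤ (3 * length C) _ _ (begin
          4 * S + 3 * length C
            ≤⟨ +-monoˡ-≤ (3 * length C) (4S≤ sC) ⟩
          4 * length C
            ≤⟨ *-monoʳ-≤ 4 (count-cover (edge? T u) (λ c → edge? T c u) C
                 (λ c∈ → edge-total T (proj₁ fC u∈ c∈))) ⟩
          4 * (length D₁ + inDeg T u C)
            ≤⟨ *-monoʳ-≤ 4 (+-monoˡ-≤ (inDeg T u C) (count-cover into? (edge? T w) D₁
                 (λ c∈ → edge-total T (proj₁ pC′ (lookup (filter-⊆ _ C) c∈) w∈C′)))) ⟩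
          4 * (length D′ + outDeg T w D₁ + inDeg T u C)
            ≤⟨ *-monoʳ-≤ 4 (+-monoˡ-≤ (inDeg T u C) (+-monoʳ-≤ (length D′)
                 (count-⊆ (edge? T w) (filter-⊆ (edge? T u) C)))) ⟩
          4 * (length D′ + outDeg T w C + inDeg T u C)
            ≡⟨ lemma (length D′) (outDeg T w C) (inDeg T u C) ⟩
          4 * length D′ + (2 * (2 * outDeg T w C) + 4 * inDeg T u C)
            ≤⟨ +-monoʳ-≤ (4 * length D′) (+-mono-≤ (*-monoʳ-≤ 2 w-light)
                 (≤-trans (*-monoˡ-≤ (inDeg T u C) 4≤q) (proj₂ fC u∈))) ⟩
          4 * length D′ + (2 * length C + length C)
            ≡⟨ cong (4 * length D′ +_) (+-comm (2 * length C) (length C)) ⟩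
          4 * length D′ + 3 * length C
            ∎))
          where
          lemma : ∀ x y z → 4 * (x + y + z) ≡ 4 * x + (2 * (2 * y) + 4 * z)
          lemma = solve-∀

        Cs₁ = map (out u) Cs
        Cs₂ = map (out w) Cs₁

        lightᵤ : All (Light q u) Cs
        lightᵤ = Light-∈ q {D = D} u∈ fs
        lightᵥ : All (Light q₁ w) Cs₁
        lightᵥ = Light-∈ q₁ {D = C′} w∈C′ (Configuration.first (restrict q₁ S u lightᵤ (configuration ps′ pss ss Cs⊆)))

        next : Configuration (t * 2 + r) S Z D′ Cs₂
        next with restrict (t * 2 + r) S w lightᵥ (restrict q₁ S u lightᵤ (configuration {D = C} ps pss ss Cs⊆))
        ... | configuration fs″ pss″ ss″ zs″ =
          configuration (All.map (λ {B} → Forward-⊆ T {t * 2 + r} {B = B} (⊆-trans (filter-⊆ _ D₁) (filter-⊆ _ C))) fs″)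
            pss″ ss″ zs″

        extend : PathIn T (t * 2) D′ (λ x → Any (x ∈_) Cs₂) → PathIn T (suc t * 2) D (λ x → Any (x ∈_) (C ∷ C′ ∷ Cs))
        extend (pathIn h tl h∈ tl∈ path len) = pathIn u (w ∷ h ∷ tl) u∈
          (there (here w∈C′) ∷ here h∈C ∷ All.map (there ∘ there ∘ proj₂) tlᵤ)
          (w→u , (u→h ∷ All.map proj₁ tlᵤ) , h→w , All.map proj₁ tlᵥ , path)
          (cong (2 +_) len)
          where
          h∈D₁ = proj₁ (∈-filter⁻ into? {xs = D₁} h∈)
          h→w = proj₂ (∈-filter⁻ into? {xs = D₁} h∈)
          h∈C = proj₁ (∈-filter⁻ (edge? T u) {xs = C} h∈D₁)
          u→h = proj₂ (∈-filter⁻ (edge? T u) {xs = C} h∈D₁)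
          tlᵥ = All.map (out-parts⁻ w Cs₁) tl∈
          tlᵤ = All.map (out-parts⁻ u Cs ∘ proj₂) tlᵥ

        found : PathIn T (suc t * 2) D (λ x → Any (x ∈_) (C ∷ C′ ∷ Cs)) ⊎ CompletePair T S Z
        found with embed t D′ Cs₂ 4≤r 1≤S
                    (≤-trans 2t≤ (≤-reflexive (sym (trans (length-map (out w) Cs₁) (length-map (out u) Cs)))))
                    (⊆-trans (filter-⊆ _ D₁) (⊆-trans (filter-⊆ _ C) C⊆)) ∣D′∣ next
        ... | inj₁ path = inj₁ (extend path)
        ... | inj₂ pair = inj₂ pair

      result : PathIn T (suc t * 2) D (λ x → Any (x ∈_) (C ∷ C′ ∷ Cs)) ⊎ CompletePair T S Z
      result with any? (λ u → any? (λ w → edge? T w u) W) D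
      ... | yes back = let u , u∈ , any = find back
                           w , w∈ , w→u = find any
                       in Found.found u∈ w∈ w→u
      ... | no ¬back = inj₂ (completePair D W D⊆ (⊆-trans (filter-⊆ _ C′) C′⊆) ∣D∣ ∣W∣
        (λ a∈ b∈ → edge-total T (λ b≡a → proj₁ fC′ a∈ (lookup (filter-⊆ light? C′) b∈) (sym b≡a))
                     (λ b→a → ¬back (lose a∈ (lose b∈ b→a)))))

  -- Large transitive subtournaments

  -- A logarithm to base 2, for k at most 2 ^ g: `g + 3` accounts for the sparsity `k * 2 + 4`, the
  -- factor `g + 2` is the number of doublings that gives more than 2k parts, and the remaining
  -- factor bounds `loss`, with `2 * g + 7` for the base `2 * q₀`.
  lossExponent : ℕ → ℕ → ℕ
  lossExponent g k = (g + 3) + (3 + (2 * g + 7) * k) * (g + 2)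

  loss-bound : ∀ {g k} → k ≤ 2 ^ g → 
               (k * 2 + 4) * loss k (k * 2 + 4) (2 ^ (g + 2)) ^ (g + 2) ≤ 2 ^ lossExponent g k
  loss-bound {g} {k} k≤ = begin
    q * ls ^ (g + 2)
      ≤⟨ *-mono-≤ q≤ (^-monoˡ-≤ (g + 2) loss≤) ⟩
    2 ^ (g + 3) * (2 ^ (3 + (2 * g + 7) * k)) ^ (g + 2)
      ≡⟨ cong (2 ^ (g + 3) *_) (^-*-assoc 2 (3 + (2 * g + 7) * k) (g + 2)) ⟩
    2 ^ (g + 3) * 2 ^ ((3 + (2 * g + 7) * k) * (g + 2))
      ≡⟨ ^-distribˡ-+-* 2 (g + 3) _ ⟨
    2 ^ lossExponent g k ∎
    where
    open ≤-Reasoning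
    q = k * 2 + 4
    m = 2 ^ (g + 2)
    ls = loss k q m

    q≤ : q ≤ 2 ^ (g + 3)
    q≤ = begin
      k * 2 + 4                 ≤⟨ +-monoˡ-≤ 4 (*-monoˡ-≤ 2 k≤) ⟩
      2 ^ g * 2 + 4 * 1         ≤⟨ +-monoʳ-≤ (2 ^ g * 2) (*-monoʳ-≤ 4 (m^n>0 2 g)) ⟩
      2 ^ g * 2 + 4 * 2 ^ g     ≤⟨ m≤m+n _ (2 * 2 ^ g) ⟩
      2 ^ g * 2 + 4 * 2 ^ g + 2 * 2 ^ g ≡⟨ lemma (2 ^ g) ⟩
      2 ^ g * 2 ^ 3             ≡⟨ ^-distribˡ-+-* 2 g 3 ⟨
      2 ^ (g + 3)               ∎
      where
      lemma : ∀ x → x * 2 + 4 * x + 2 * x ≡ x * 8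
      lemma = solve-∀

    2q₀≤ : 2 * (q * (2 * m)) ≤ 2 ^ (2 * g + 7)
    2q₀≤ = begin
      2 * (q * (2 * m))                        ≤⟨ *-monoʳ-≤ 2 (*-monoˡ-≤ (2 * m) q≤) ⟩
      2 * (2 ^ (g + 3) * (2 * 2 ^ (g + 2)))    ≡⟨ cong (2 *_) (^-distribˡ-+-* 2 (g + 3) (suc (g + 2))) ⟨
      2 ^ (1 + (g + 3 + (1 + (g + 2))))        ≡⟨ cong (2 ^_) (lemma g) ⟩
      2 ^ (2 * g + 7)                          ∎
      where
      lemma : ∀ g → 1 + (g + 3 + (1 + (g + 2))) ≡ 2 * g + 7
      lemma = solve-∀

    loss≤ : ls ≤ 2 ^ (3 + (2 * g + 7) * k)
    loss≤ = begin
      2 * (4 * (2 * (q * (2 * m))) ^ k)      ≤⟨ *-monoʳ-≤ 2 (*-monoʳ-≤ 4 (^-monoˡ-≤ k 2q₀≤)) ⟩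
      2 * (4 * (2 ^ (2 * g + 7)) ^ k)        ≡⟨ cong (λ z → 2 * (4 * z)) (^-*-assoc 2 (2 * g + 7) k) ⟩
      2 * (4 * 2 ^ ((2 * g + 7) * k))        ≡⟨ *-assoc 2 4 (2 ^ ((2 * g + 7) * k)) ⟨
      8 * 2 ^ ((2 * g + 7) * k)              ≡⟨ ^-distribˡ-+-* 2 3 ((2 * g + 7) * k) ⟨
      2 ^ (3 + (2 * g + 7) * k)              ∎

  module _ {n} (T : Tournament n) where

    private
      V = Fin n
      E = Edge T

    -- The sparsity `k * 2 + 4` pays one unit for each of the `k * 2` restrictions to an
    -- out-neighbourhood and still leaves the 4 required in the last round. The path obtained has 2k
    -- + 1 vertices, comfortably more than k.
    parts⇒path-or-complete : ∀ k ℓ {S Z} → 1 ≤ S → k * 2 < 2 ^ ℓ → Parts T (k * 2 + 4) ((k * 2 + 4) * S) ℓ Z →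
                             ∃ (λ vs → IsPath T vs × k ≤ length vs) ⊎ CompletePair T S Z
    parts⇒path-or-complete k ℓ 1≤S 2k< (mkParts [] number _ _ _) = ⊥-elim (<⇒≢ (m^n>0 2 ℓ) number)
    parts⇒path-or-complete k ℓ {S} {Z} 1≤S 2k< (mkParts (D ∷ Cs) number (f ∷ fs) (s ∷ ss) (D⊆ ∷ Cs⊆)) =
      finish (embed T k {4} {S} D Cs ≤-refl 1≤S (s≤s⁻¹ (≤-trans 2k< (≤-reflexive (sym number)))) D⊆
                (≤-trans (m≤n*m S (k * 2 + 4) ⦃ >-nonZero (≤-trans (s≤s z≤n) (m≤n+m 4 (k * 2))) ⦄) s)
                (configuration f fs ss Cs⊆))
      where
      finish : PathIn T (k * 2) D (λ x → Any (x ∈_) Cs) ⊎ CompletePair T S Z →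
               ∃ (λ vs → IsPath T vs × k ≤ length vs) ⊎ CompletePair T S Z
      finish (inj₂ pair) = inj₂ pair
      finish (inj₁ (pathIn h tl _ _ path len)) =
        inj₁ (h ∷ tl , path , ≤-trans (m≤m*n k 2) (≤-trans (≤-reflexive (sym len)) (n≤1+n _)))

    path-or-complete : ∀ k ℓ S Z → 1 ≤ S → k * 2 < 2 ^ ℓ → Unique Z →
                       S * ((k * 2 + 4) * loss k (k * 2 + 4) (2 ^ ℓ) ^ ℓ) ≤ length Z →
                       ∃ (λ vs → IsPath T vs × k ≤ length vs) ⊎ CompletePair T S Z
    path-or-complete k ℓ S Z 1≤S 2k< uniq ∣Z∣ =
      finish (path-or-parts T k q (2 ^ ℓ) 1≤q (m^n>0 2 ℓ) ℓ (q * S) Z ≤-refl (*-mono-≤ 1≤q 1≤S) uniq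
                (≤-trans (≤-reflexive (lemma q S (loss k q (2 ^ ℓ) ^ ℓ))) ∣Z∣))
      where
      q = k * 2 + 4
      1≤q : 1 ≤ q
      1≤q = ≤-trans (s≤s z≤n) (m≤n+m 4 (k * 2))
      lemma : ∀ q S x → q * S * x ≡ S * (q * x)
      lemma = solve-∀
      finish : ∃ (λ vs → IsPath T vs × length vs ≡ suc k) ⊎ Parts T q (q * S) ℓ Z →
               ∃ (λ vs → IsPath T vs × k ≤ length vs) ⊎ CompletePair T S Z
      finish (inj₁ (vs , path , len)) = inj₁ (vs , path , ≤-trans (n≤1+n k) (≤-reflexive (sym len)))
      finish (inj₂ parts)             = parts⇒path-or-complete k ℓ 1≤S 2k< parts

    path-lookup : ∀ vs → IsPath T vs → ∀ {i j} → PathEdge i j → E (List.lookup vs i) (List.lookup vs j)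
    path-lookup (v ∷ w ∷ vs) (e , _ , _) {suc zero} {zero} (inj₁ refl) = e
    path-lookup (v ∷ w ∷ vs) (_ , _ , p) {suc i} {suc j} (inj₁ eq) = path-lookup (w ∷ vs) p (inj₁ (suc-injective eq))
    path-lookup (v ∷ w ∷ vs) (_ , es , _) {zero} {suc zero} (inj₂ (_ , ≢)) = ⊥-elim (≢ refl)
    path-lookup (v ∷ w ∷ vs) (_ , es , _) {zero} {suc (suc j)} (inj₂ _) = All.lookup es (∈-lookup j)
    path-lookup (v ∷ w ∷ vs) (_ , _ , p) {suc i} {suc j} (inj₂ (i<j , ≢)) =
      path-lookup (w ∷ vs) p (inj₂ (s≤s⁻¹ i<j , ≢ ∘ cong suc))
    path-lookup (v ∷ [])     _           {zero} {zero} (inj₁ ())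

    -- An initial segment of a path is a path. Only preservation of edges needs the path structure:
    -- between tournaments it already forces injectivity and reflection of edges.
    path-contained : ∀ {k} vs → IsPath T vs → k ≤ length vs → ¬ (P k -Free T)
    path-contained {k} vs path k≤ free = free (k , mk↣ f-injective , record
      { bijection = ↔-id (Fin k)
      ; edges     = λ u v → mk⇔ (reflects u v) preserves
      })
      where
      f : Fin k → V
      f i = List.lookup vs (inject≤ i k≤)
      preserves : ∀ {u v} → PathEdge u v → E (f u) (f v)
      preserves {u} {v} e = path-lookup vs path
        (subst₂ (λ a b → a ≡ suc b ⊎ (a < b × b ≢ suc a))
          (sym (Fin.toℕ-inject≤ u k≤)) (sym (Fin.toℕ-inject≤ v k≤)) e)
      f-injective : Injective _≡_ _≡_ f
      f-injective {u} {v} fu≡fv with u Fin.≟ v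
      ... | yes u≡v = u≡v
      ... | no  u≢v with Tournament.exactlyOne (P k) u v u≢v
      ...   | inj₁ (e , _) = ⊥-elim (Tournament.irrefl T (f v) (subst (λ x → E x (f v)) fu≡fv (preserves e)))
      ...   | inj₂ (e , _) = ⊥-elim (Tournament.irrefl T (f v) (subst (E (f v)) fu≡fv (preserves e)))
      reflects : ∀ u v → E (f u) (f v) → PathEdge u v
      reflects u v e with u Fin.≟ v
      ... | yes refl = ⊥-elim (Tournament.irrefl T (f u) e)
      ... | no  u≢v with Tournament.exactlyOne (P k) u v u≢v
      ...   | inj₁ (e′ , _) = e′
      ...   | inj₂ (e′ , _) = ⊥-elim (edge-asym T e (preserves e′))

    large-chain : ∀ g k → k ≤ 2 ^ g → P k -Free T → ∀ j Z → Unique Z →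
                  (2 ^ lossExponent g k) ^ j ≤ length Z →
                  ∃ λ vs → All (_∈ Z) vs × AllPairs E vs × length vs ≡ 2 ^ j
    large-chain g k k≤ free zero Z uniq 1≤ =
      let z , z∈ = nonempty 1≤ in z ∷ [] , z∈ ∷ [] , [] ∷ [] , refl
    large-chain g k k≤ free (suc j) Z uniq ∣Z∣ = finish
      (path-or-complete k (g + 2) (C ^ j) Z (m^n>0 C ⦃ m^n≢0 2 (lossExponent g k) ⦄ j) 2k< uniq
        (≤-trans (*-monoʳ-≤ (C ^ j) (loss-bound {g} {k} k≤)) (≤-trans (≤-reflexive (*-comm (C ^ j) C)) ∣Z∣)))
      where
      C = 2 ^ lossExponent g k
      2k< : k * 2 < 2 ^ (g + 2)
      2k< = begin
        1 + k * 2              ≤⟨ +-mono-≤ (m^n>0 2 g) (*-monoˡ-≤ 2 k≤) ⟩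
        2 ^ g + 2 ^ g * 2      ≤⟨ m≤m+n _ (2 ^ g) ⟩
        2 ^ g + 2 ^ g * 2 + 2 ^ g ≡⟨ lemma (2 ^ g) ⟩
        2 ^ g * 2 ^ 2          ≡⟨ ^-distribˡ-+-* 2 g 2 ⟨
        2 ^ (g + 2)            ∎
        where
        open ≤-Reasoning
        lemma : ∀ x → x + x * 2 + x ≡ x * 4
        lemma = solve-∀
      finish : ∃ (λ vs → IsPath T vs × k ≤ length vs) ⊎ CompletePair T (C ^ j) Z →
               ∃ λ vs → All (_∈ Z) vs × AllPairs E vs × length vs ≡ 2 ^ suc j
      finish (inj₁ (vs , path , k≤∣vs∣)) = ⊥-elim (path-contained vs path k≤∣vs∣ free)
      finish (inj₂ (completePair A B A⊆ B⊆ ∣A∣ ∣B∣ A→B)) =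
        let us , us∈ , us! , #us = large-chain g k k≤ free j A (AllPairs-resp-⊆ A⊆ uniq) ∣A∣
            vs , vs∈ , vs! , #vs = large-chain g k k≤ free j B (AllPairs-resp-⊆ B⊆ uniq) ∣B∣
        in us ++ vs ,
           All.++⁺ (All.map (lookup A⊆) us∈) (All.map (lookup B⊆) vs∈) ,
           AllPairs.++⁺ us! vs! (All.map (λ a∈ → All.map (A→B a∈) vs∈) us∈) ,
           trans (length-++ us) (cong₂ _+_ #us (trans #vs (sym (+-identityʳ _))))

    AllPairs-lookup : ∀ {vs} → AllPairs E vs → ∀ {i j} → i Fin.< j → E (List.lookup vs i) (List.lookup vs j)
    AllPairs-lookup (es ∷ _)  {zero}  {suc j} _   = All.lookup es (∈-lookup j)
    AllPairs-lookup (_ ∷ ess) {suc i} {suc j} i<j = AllPairs-lookup ess (s≤s⁻¹ i<j)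

    chain-transitive : ∀ vs → AllPairs E vs → Σ (Fin (length vs) ↣ V) λ f → Transitive (induced T f)
    chain-transitive vs vs! = mk↣ f-injective , acyclic
      where
      f = List.lookup vs
      f-injective : Injective _≡_ _≡_ f
      f-injective {u} {v} fu≡fv with Fin.<-cmp u v
      ... | tri< u<v _ _ = ⊥-elim (Tournament.irrefl T (f v) (subst (λ x → E x (f v)) fu≡fv (AllPairs-lookup vs! u<v)))
      ... | tri≈ _ u≡v _ = u≡v
      ... | tri> _ _ v<u = ⊥-elim (Tournament.irrefl T (f v) (subst (E (f v)) fu≡fv (AllPairs-lookup vs! v<u)))
      increasing : ∀ {u v} → E (f u) (f v) → u Fin.< v
      increasing {u} {v} e with Fin.<-cmp u v
      ... | tri< u<v _ _  = u<v
      ... | tri≈ _ refl _ = ⊥-elim (Tournament.irrefl T (f v) e)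
      ... | tri> _ _ v<u  = ⊥-elim (edge-asym T e (AllPairs-lookup vs! v<u))
      first≤last : ∀ {ℓ} (c : Fin (suc ℓ) → Fin (length vs)) → (∀ i → c (inject₁ i) Fin.< c (suc i)) →
                   c zero Fin.≤ c (fromℕ ℓ)
      first≤last {zero}  c step = ≤-refl
      first≤last {suc ℓ} c step = ≤-trans (<⇒≤ (step zero)) (first≤last (c ∘ suc) (step ∘ suc))
      acyclic : Transitive (induced T (mk↣ f-injective))
      acyclic cycle = <⇒≱ (increasing close) (first≤last c (increasing ∘ step))
        where open DirectedCycle cycle

    edge-chain : 2 ≤ n → ∃ λ vs → AllPairs E vs × length vs ≡ 2
    edge-chain (s≤s (s≤s _)) with edge? T zero (suc zero)
    ... | yes e = zero ∷ suc zero ∷ [] , (e ∷ []) ∷ [] ∷ [] , refl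
    ... | no ¬e = suc zero ∷ zero ∷ [] , (edge-total T (λ ()) ¬e ∷ []) ∷ [] ∷ [] , refl

  log-bracket : ∀ C n → 2 ≤ C → 1 ≤ n → ∃ λ j → C ^ j ≤ n × n < C ^ suc j
  log-bracket C (suc zero)    2≤C _ = 0 , ≤-refl , ≤-trans 2≤C (≤-reflexive (sym (*-identityʳ C)))
  log-bracket C (suc (suc n)) 2≤C _ with log-bracket C (suc n) 2≤C (s≤s z≤n)
  ... | j , lo , hi with suc (suc n) <? C ^ suc j
  ...   | yes hi′ = j , m≤n⇒m≤1+n lo , hi′
  ...   | no ¬hi  = suc j , ≮⇒≥ ¬hi , (begin-strict
          suc (suc n)   ≤⟨ hi ⟩
          C ^ suc j     <⟨ ^-monoʳ-< C 2≤C (n<1+n (suc j)) ⟩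
          C ^ suc (suc j) ∎)
          where open ≤-Reasoning

  -- The factor 2 in front of the loss exponent absorbs the rounding of the logarithm of n to base
  -- `C`: for n below `C ^ (j + 2)` a chain of length `2 ^ (j + 1)` suffices, since j + 2 is at most
  -- 2 (j + 1). Below `C` a single edge is enough.
  EHExponent-path : ∀ g k d → k ≤ 2 ^ g → 2 * lossExponent g k ≡ suc d → EHExponent (P k) (mkℚᵘ (ℤ.+ 1) d)
  EHExponent-path g k d k≤ 2L≡ = *≤* (+≤+ z≤n) , λ n 1≤n T free → large n 1≤n T free
    where
    open ≤-Reasoning
    L = lossExponent g k
    C = 2 ^ L
    3≤L : 3 ≤ L
    3≤L = ≤-trans (m≤n+m 3 g) (m≤m+n (g + 3) _)
    2≤C : 2 ≤ C
    2≤C = ^-monoʳ-≤ 2 (≤-trans (s≤s z≤n) 3≤L)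

    result : ∀ {n} (T : Tournament n) vs → AllPairs (Edge T) vs → n ≤ length vs ^ (2 * L) →
             Σ ℕ λ m → Σ (Fin m ↣ Fin n) λ f → Transitive (induced T f) × AtLeastPower m n (mkℚᵘ (ℤ.+ 1) d)
    result {n} T vs vs! n≤ = let f , tr = chain-transitive T vs vs! in
      length vs , f , tr , ≤-trans (≤-reflexive (*-identityʳ n)) (≤-trans n≤ (≤-reflexive (cong (length vs ^_) 2L≡)))

    large : ∀ n → 1 ≤ n → (T : Tournament n) → P k -Free T →
            Σ ℕ λ m → Σ (Fin m ↣ Fin n) λ f → Transitive (induced T f) × AtLeastPower m n (mkℚᵘ (ℤ.+ 1) d)
    large (suc zero) 1≤n T free = result T (zero ∷ []) ([] ∷ []) (≤-reflexive (sym (^-zeroˡ (2 * L))))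
    large n@(suc (suc _)) 1≤n T free with log-bracket C n 2≤C 1≤n
    ... | zero , _ , n<C = let vs , vs! , #vs = edge-chain T (s≤s (s≤s z≤n)) in
      result T vs vs! (begin
        n                       ≤⟨ <⇒≤ n<C ⟩
        C * 1                   ≡⟨ *-identityʳ C ⟩
        2 ^ L                   ≤⟨ ^-monoʳ-≤ 2 (m≤m+n L _) ⟩
        2 ^ (2 * L)             ≡⟨ cong (_^ (2 * L)) #vs ⟨
        length vs ^ (2 * L)     ∎)
    ... | suc j , C^j≤n , n< =
      let vs , _ , vs! , #vs = large-chain T g k k≤ free (suc j) (allFin n) (allFin⁺ n)
                                 (≤-trans C^j≤n (≤-reflexive (sym (length-tabulate {n = n} (λ i → i)))))
      in result T vs vs! (begin
        n                             ≤⟨ <⇒≤ n< ⟩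
        C ^ suc (suc j)               ≤⟨ ^-monoʳ-≤ C ⦃ >-nonZero (≤-trans (s≤s z≤n) 2≤C) ⦄
                                         (≤-trans (m≤m+n _ j) (≤-reflexive (lemma j))) ⟩
        (2 ^ L) ^ (2 * suc j)         ≡⟨ ^-*-assoc 2 L (2 * suc j) ⟩
        2 ^ (L * (2 * suc j))         ≡⟨ cong (2 ^_) (lemma′ L (suc j)) ⟩
        2 ^ (suc j * (2 * L))         ≡⟨ ^-*-assoc 2 (suc j) (2 * L) ⟨
        (2 ^ suc j) ^ (2 * L)         ≡⟨ cong (_^ (2 * L)) #vs ⟨
        length vs ^ (2 * L)           ∎)
      where
      lemma : ∀ j → 2 + j + j ≡ 2 * (1 + j)
      lemma = solve-∀
      lemma′ : ∀ x y → x * (2 * y) ≡ y * (2 * x)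
      lemma′ = solve-∀

  -- The union bound

  Σᵇ : ∀ {N} → (Vec Bool N → ℕ) → ℕ
  Σᵇ {zero}  F = F []
  Σᵇ {suc N} F = Σᵇ (F ∘ (true ∷_)) + Σᵇ (F ∘ (false ∷_))

  Σᵇ-cong : ∀ {N} {F G : Vec Bool N → ℕ} → (∀ x → F x ≡ G x) → Σᵇ F ≡ Σᵇ G
  Σᵇ-cong {zero}  h = h []
  Σᵇ-cong {suc N} h = cong₂ _+_ (Σᵇ-cong (h ∘ (true ∷_))) (Σᵇ-cong (h ∘ (false ∷_)))

  Σᵇ-+ : ∀ {N} (F G : Vec Bool N → ℕ) → Σᵇ (λ x → F x + G x) ≡ Σᵇ F + Σᵇ G
  Σᵇ-+ {zero}  F G = refl
  Σᵇ-+ {suc N} F G = trans (cong₂ _+_ (Σᵇ-+ (F ∘ (true ∷_)) (G ∘ (true ∷_))) (Σᵇ-+ (F ∘ (false ∷_)) (G ∘ (false ∷_))))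
                           (lemma (Σᵇ (F ∘ (true ∷_))) (Σᵇ (G ∘ (true ∷_))) _ _)
    where
    lemma : ∀ u v w z → u + v + (w + z) ≡ u + w + (v + z)
    lemma = solve-∀

  Σᵇ-const : ∀ N c → Σᵇ {N} (λ _ → c) ≡ c * 2 ^ N
  Σᵇ-const zero    c = sym (*-identityʳ c)
  Σᵇ-const (suc N) c = trans (cong₂ _+_ (Σᵇ-const N c) (Σᵇ-const N c)) (lemma c (2 ^ N))
    where
    lemma : ∀ c x → c * x + c * x ≡ c * (2 * x)
    lemma = solve-∀

  flip : ∀ {N} → Fin N → Vec Bool N → Vec Bool N
  flip c x = updateAt x c not

  Σᵇ-flip : ∀ {N} c (F : Vec Bool N → ℕ) → Σᵇ (F ∘ flip c) ≡ Σᵇ F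
  Σᵇ-flip zero    F = +-comm (Σᵇ (F ∘ (false ∷_))) _
  Σᵇ-flip (suc c) F = cong₂ _+_ (Σᵇ-flip c (F ∘ (true ∷_))) (Σᵇ-flip c (F ∘ (false ∷_)))

  -- If the average over the cube is below 1, it is below 1 over one of the two halves; descending
  -- through the halves finds the point.
  Σᵇ<⇒zero : ∀ {N} (F : Vec Bool N → ℕ) → Σᵇ F < 2 ^ N → ∃ λ x → F x ≡ 0
  Σᵇ<⇒zero {zero}  F h = [] , n<1⇒n≡0 h
  Σᵇ<⇒zero {suc N} F h with Σᵇ (F ∘ (true ∷_)) <? 2 ^ N
  ... | yes h₁ = let x , eq = Σᵇ<⇒zero _ h₁ in true ∷ x , eq
  ... | no ¬h₁ with Σᵇ (F ∘ (false ∷_)) <? 2 ^ N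
  ...   | yes h₂ = let x , eq = Σᵇ<⇒zero _ h₂ in false ∷ x , eq
  ...   | no ¬h₂ = ⊥-elim (<⇒≱ h (≤-trans (≤-reflexive (cong (2 ^ N +_) (+-identityʳ _))) (+-mono-≤ (≮⇒≥ ¬h₁) (≮⇒≥ ¬h₂))))

  Constraint : ℕ → Set
  Constraint N = Fin N × Bool

  agree : Bool → Bool → ℕ
  agree true  true  = 1
  agree false false = 1
  agree _     _     = 0

  agree-not : ∀ x b → agree x b + agree (not x) b ≡ 1
  agree-not true  true  = refl
  agree-not true  false = refl
  agree-not false true  = refl
  agree-not false false = refl

  agree-refl : ∀ b → agree b b ≡ 1
  agree-refl true  = refl
  agree-refl false = refl

  -- The indicator is a product, so flipping a coordinate changes only the factors at that
  -- coordinate.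
  satisfied : ∀ {N} → List (Constraint N) → Vec Bool N → ℕ
  satisfied []             x = 1
  satisfied ((c , b) ∷ cs) x = agree (Vec.lookup x c) b * satisfied cs x

  Satisfies : ∀ {N} → Vec Bool N → Constraint N → Set
  Satisfies x (c , b) = Vec.lookup x c ≡ b

  satisfied-≡1 : ∀ {N} (x : Vec Bool N) {cs} → All (Satisfies x) cs → satisfied cs x ≡ 1
  satisfied-≡1 x []                   = refl
  satisfied-≡1 x (_∷_ {c , b} eq eqs) = cong₂ _*_ (trans (cong (λ y → agree y b) eq) (agree-refl b)) (satisfied-≡1 x eqs)

  satisfied-flip : ∀ {N} c (x : Vec Bool N) cs → All (c ≢_) (map proj₁ cs) →
                   satisfied cs (flip c x) ≡ satisfied cs x
  satisfied-flip c x []              []         = refl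
  satisfied-flip c x ((c′ , b) ∷ cs) (c≢ ∷ c∉)  =
    cong₂ (λ y z → agree y b * z) (lookup∘updateAt′ c′ c (≢-sym c≢) x) (satisfied-flip c x cs c∉)

  -- Flipping the coordinate c exchanges the assignments that satisfy a constraint
  -- at c with those that violate it.
  satisfied-count : ∀ {N} (cs : List (Constraint N)) → Unique (map proj₁ cs) →
                    Σᵇ (satisfied cs) * 2 ^ length cs ≡ 2 ^ N
  satisfied-count {N} [] _ = trans (*-identityʳ _) (trans (Σᵇ-const N 1) (*-identityˡ _))
  satisfied-count {N} ((c , b) ∷ cs) (c∉ ∷ uniq) = begin
    Σᵇ G * (2 * 2 ^ length cs)              ≡⟨ lemma (Σᵇ G) (2 ^ length cs) ⟩
    (Σᵇ G + Σᵇ G) * 2 ^ length cs           ≡⟨ cong (_* 2 ^ length cs) halves ⟩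
    Σᵇ (satisfied cs) * 2 ^ length cs       ≡⟨ satisfied-count cs uniq ⟩
    2 ^ N                                   ∎
    where
    open ≡-Reasoning
    G = satisfied ((c , b) ∷ cs)
    lemma : ∀ u v → u * (2 * v) ≡ (u + u) * v
    lemma = solve-∀
    pointwise : ∀ x → G x + G (flip c x) ≡ satisfied cs x
    pointwise x = begin
      G x + G (flip c x)
        ≡⟨ cong (G x +_) (cong₂ (λ y z → agree y b * z) (lookup∘updateAt c x) (satisfied-flip c x cs c∉)) ⟩
      agree y b * satisfied cs x + agree (not y) b * satisfied cs x
        ≡⟨ *-distribʳ-+ (satisfied cs x) (agree y b) (agree (not y) b) ⟨
      (agree y b + agree (not y) b) * satisfied cs x
        ≡⟨ cong (_* satisfied cs x) (agree-not y b) ⟩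
      1 * satisfied cs x
        ≡⟨ *-identityˡ _ ⟩
      satisfied cs x ∎
      where y = Vec.lookup x c
    halves : Σᵇ G + Σᵇ G ≡ Σᵇ (satisfied cs)
    halves = begin
      Σᵇ G + Σᵇ G                   ≡⟨ cong (Σᵇ G +_) (Σᵇ-flip c G) ⟨
      Σᵇ G + Σᵇ (G ∘ flip c)        ≡⟨ Σᵇ-+ G (G ∘ flip c) ⟨
      Σᵇ (λ x → G x + G (flip c x)) ≡⟨ Σᵇ-cong pointwise ⟩
      Σᵇ (satisfied cs)             ∎

  Σ≡0 : ∀ {A : Set} (f : A → ℕ) xs → Σ[ xs ] f ≡ 0 → All (λ x → f x ≡ 0) xs
  Σ≡0 f []       _  = []
  Σ≡0 f (x ∷ xs) eq = m+n≡0⇒m≡0 (f x) eq ∷ Σ≡0 f xs (m+n≡0⇒n≡0 (f x) eq)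

  union-bound : ∀ {N} s (css : List (List (Constraint N))) →
                All (λ cs → Unique (map proj₁ cs) × length cs ≡ s) css → length css < 2 ^ s →
                ∃ λ x → All (λ cs → ¬ All (Satisfies x) cs) css
  union-bound {N} s css good few =
    let x , eq = Σᵇ<⇒zero total (*-cancelʳ-< (2 ^ s) _ _ total<)
    in x , All.map (λ eq₀ sat → case (trans (sym (satisfied-≡1 x sat)) eq₀)) (Σ≡0 (λ cs → satisfied cs x) css eq)
    where
    case : ¬ (1 ≡ 0)
    case ()
    total = λ x → Σ[ css ] (λ cs → satisfied cs x)
    total≡ : ∀ css → All (λ cs → Unique (map proj₁ cs) × length cs ≡ s) css →
             Σᵇ {N} (λ x → Σ[ css ] (λ cs → satisfied cs x)) * 2 ^ s ≡ length css * 2 ^ N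
    total≡ []         []                  = cong (_* 2 ^ s) (Σᵇ-const N 0)
    total≡ (cs ∷ css) ((uniq , refl) ∷ h) = trans
      (cong (_* 2 ^ s) (Σᵇ-+ (satisfied cs) _))
      (trans (*-distribʳ-+ (2 ^ s) (Σᵇ (satisfied cs)) _) (cong₂ _+_ (satisfied-count cs uniq) (total≡ css h)))
    total< : Σᵇ total * 2 ^ s < 2 ^ N * 2 ^ s
    total< = begin-strict
      Σᵇ total * 2 ^ s     ≡⟨ total≡ css good ⟩
      length css * 2 ^ N   <⟨ *-monoˡ-< (2 ^ N) ⦃ m^n≢0 2 N ⦄ few ⟩
      2 ^ s * 2 ^ N        ≡⟨ *-comm (2 ^ s) _ ⟩
      2 ^ N * 2 ^ s        ∎
      where open ≤-Reasoning

  -- Random tournaments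

  length-cartesianProductWith : ∀ {A B C : Set} (f : A → B → C) xs ys →
    length (cartesianProductWith f xs ys) ≡ length xs * length ys
  length-cartesianProductWith f []       ys = refl
  length-cartesianProductWith f (x ∷ xs) ys =
    trans (length-++ (map (f x) ys)) (cong₂ _+_ (length-map (f x) ys) (length-cartesianProductWith f xs ys))

  -- The binomial coefficient k (k - 1) / 2, the number of pairs among k vertices.
  tri : ℕ → ℕ
  tri zero    = 0
  tri (suc k) = k + tri k

  chainPairs : ∀ {A : Set} → List A → List (A × A)
  chainPairs []       = []
  chainPairs (v ∷ vs) = map (v ,_) vs ++ chainPairs vs

  pathPairs : ∀ {A : Set} → List A → List (A × A)
  pathPairs []           = []
  pathPairs (v ∷ [])     = []
  pathPairs (v ∷ w ∷ vs) = (w , v) ∷ map (v ,_) vs ++ pathPairs (w ∷ vs)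

  length-chainPairs : ∀ {A : Set} (vs : List A) → length (chainPairs vs) ≡ tri (length vs)
  length-chainPairs []       = refl
  length-chainPairs (v ∷ vs) = trans (length-++ (map (v ,_) vs)) (cong₂ _+_ (length-map (v ,_) vs) (length-chainPairs vs))

  chainPairs-∈ : ∀ {A : Set} (vs : List A) → All (λ { (a , b) → a ∈ vs × b ∈ vs }) (chainPairs vs)
  chainPairs-∈ []       = []
  chainPairs-∈ (v ∷ vs) = All.++⁺ (All.map⁺ (All.tabulate (λ w∈ → here refl , there w∈)))
                                  (All.map (λ { (a∈ , b∈) → there a∈ , there b∈ }) (chainPairs-∈ vs))

  module _ {n : ℕ} where

    private
      V = Fin n

    -- An arc is recorded at the coordinate of the increasing pair of its ends, with `false` if it
    -- points downwards. The diagonal case is a default value.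
    constraint : V × V → Constraint (n * n)
    constraint (a , b) with Fin.<-cmp a b
    ... | tri< _ _ _ = combine a b , true
    ... | tri≈ _ _ _ = combine a b , true
    ... | tri> _ _ _ = combine b a , false

    key : V × V → Fin (n * n)
    key = proj₁ ∘ constraint

    key-sym : ∀ a b → key (a , b) ≡ key (b , a)
    key-sym a b with Fin.<-cmp a b | Fin.<-cmp b a
    ... | tri< a<b _ _  | tri< b<a _ _  = ⊥-elim (Fin.<-asym a<b b<a)
    ... | tri< a<b _ _  | tri≈ _ refl _ = refl
    ... | tri< _ _ _    | tri> _ _ _    = refl
    ... | tri≈ _ refl _ | tri< _ _ _    = refl
    ... | tri≈ _ refl _ | tri≈ _ _ _    = refl
    ... | tri≈ _ refl _ | tri> _ _ _    = refl
    ... | tri> _ _ _    | tri< _ _ _    = refl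
    ... | tri> _ _ b<a  | tri≈ _ refl _ = refl
    ... | tri> _ _ b<a  | tri> _ _ a<b  = ⊥-elim (Fin.<-asym a<b b<a)

    key-unordered : ∀ a b → key (a , b) ≡ combine a b ⊎ key (a , b) ≡ combine b a
    key-unordered a b with Fin.<-cmp a b
    ... | tri< _ _ _ = inj₁ refl
    ... | tri≈ _ _ _ = inj₁ refl
    ... | tri> _ _ _ = inj₂ refl

    key-injective : ∀ a b c d → key (a , b) ≡ key (c , d) → (a ≡ c × b ≡ d) ⊎ (a ≡ d × b ≡ c)
    key-injective a b c d eq with key-unordered a b | key-unordered c d
    ... | inj₁ p | inj₁ q = inj₁ (Fin.combine-injective a b c d (trans (sym p) (trans eq q)))
    ... | inj₁ p | inj₂ q = inj₂ (Fin.combine-injective a b d c (trans (sym p) (trans eq q)))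
    ... | inj₂ p | inj₁ q = let x , y = Fin.combine-injective b a c d (trans (sym p) (trans eq q)) in inj₂ (y , x)
    ... | inj₂ p | inj₂ q = let x , y = Fin.combine-injective b a d c (trans (sym p) (trans eq q)) in inj₁ (y , x)

    keys-unique : ∀ vs → Unique vs → Unique (map key (chainPairs vs))
    keys-unique vs u = AllPairs.map⁺ (go vs u)
      where
      go : ∀ vs → Unique vs → AllPairs (_≢_ on key) (chainPairs vs)
      go []       []        = []
      go (v ∷ vs) (v∉ ∷ u) = AllPairs.++⁺
        (AllPairs.map⁺ (AllPairs.map (λ {w} {w′} w≢w′ eq → distinct w w′ w≢w′ (key-injective v w v w′ eq)) u))
        (go vs u)
        (All.map⁺ (All.tabulate (λ {w} _ → All.map
          (λ { {a , b} (a∈ , b∈) eq → fresh w a b a∈ b∈ (key-injective v w a b eq) }) (chainPairs-∈ vs))))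
        where
        distinct : ∀ w w′ → w ≢ w′ → ¬ ((v ≡ v × w ≡ w′) ⊎ (v ≡ w′ × w ≡ v))
        distinct w w′ w≢w′ (inj₁ (_ , eq))   = w≢w′ eq
        distinct w w′ w≢w′ (inj₂ (eq , eq′)) = w≢w′ (trans eq′ eq)
        fresh : ∀ w a b → a ∈ vs → b ∈ vs → ¬ ((v ≡ a × w ≡ b) ⊎ (v ≡ b × w ≡ a))
        fresh w a b a∈ b∈ (inj₁ (eq , _)) = All.lookup v∉ a∈ eq
        fresh w a b a∈ b∈ (inj₂ (eq , _)) = All.lookup v∉ b∈ eq

    -- A path and a chain on the same list differ only in the orientation of consecutive pairs,
    -- which `key` forgets. Distinctness and number of the coordinates are thus checked for chains
    -- alone.
    pathKeys : ∀ vs → map key (pathPairs vs) ≡ map key (chainPairs vs)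
    pathKeys []           = refl
    pathKeys (v ∷ [])     = refl
    pathKeys (v ∷ w ∷ vs) = cong₂ _∷_ (key-sym w v) (begin
      map key (map (v ,_) vs ++ pathPairs (w ∷ vs))            ≡⟨ map-++ key (map (v ,_) vs) _ ⟩
      map key (map (v ,_) vs) ++ map key (pathPairs (w ∷ vs))  ≡⟨ cong (map key (map (v ,_) vs) ++_) (pathKeys (w ∷ vs)) ⟩
      map key (map (v ,_) vs) ++ map key (chainPairs (w ∷ vs)) ≡⟨ map-++ key (map (v ,_) vs) _ ⟨
      map key (map (v ,_) vs ++ chainPairs (w ∷ vs))           ∎)
      where open ≡-Reasoning

    fromBits : Vec Bool (n * n) → Tournament n
    fromBits x = record
      { Edge       = Arc
      ; irrefl     = λ { u (inj₁ (u<u , _)) → Fin.<-irrefl refl u<u ; u (inj₂ (u<u , _)) → Fin.<-irrefl refl u<u }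
      ; exactlyOne = exactly
      }
      where
      Arc : V → V → Set
      Arc u v = (u Fin.< v × Vec.lookup x (combine u v) ≡ true)
              ⊎ (v Fin.< u × Vec.lookup x (combine v u) ≡ false)
      asym : ∀ {u v} → Arc u v → ¬ Arc v u
      asym (inj₁ (lt , _)) (inj₁ (gt , _)) = Fin.<-asym lt gt
      asym (inj₁ (_ , eq)) (inj₂ (_ , eq′)) with trans (sym eq) eq′
      ... | ()
      asym (inj₂ (_ , eq)) (inj₁ (_ , eq′)) with trans (sym eq) eq′
      ... | ()
      asym (inj₂ (lt , _)) (inj₂ (gt , _)) = Fin.<-asym lt gt
      total : ∀ {u v} → u Fin.< v → Arc u v ⊎ Arc v u
      total {u} {v} u<v with Vec.lookup x (combine u v)
      ... | true  = inj₁ (inj₁ (u<v , refl))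
      ... | false = inj₂ (inj₂ (u<v , refl))
      both : ∀ {u v} → Arc u v ⊎ Arc v u → (Arc u v × ¬ Arc v u) ⊎ (Arc v u × ¬ Arc u v)
      both (inj₁ e) = inj₁ (e , asym e)
      both (inj₂ e) = inj₂ (e , asym e)
      exactly : ∀ u v → u ≢ v → (Arc u v × ¬ Arc v u) ⊎ (Arc v u × ¬ Arc u v)
      exactly u v u≢v with Fin.<-cmp u v
      ... | tri< u<v _ _ = both (total u<v)
      ... | tri≈ _ u≡v _ = ⊥-elim (u≢v u≡v)
      ... | tri> _ _ v<u = swap (both (total v<u))

    edge-constraint : ∀ x {a b} → Edge (fromBits x) a b → Satisfies x (constraint (a , b))
    edge-constraint x {a} {b} e with Fin.<-cmp a b
    edge-constraint x (inj₁ (_ , eq))   | tri< _ _ _    = eq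
    edge-constraint x (inj₂ (b<a , _))  | tri< a<b _ _  = ⊥-elim (Fin.<-asym a<b b<a)
    edge-constraint x (inj₁ (a<a , _))  | tri≈ _ refl _ = ⊥-elim (Fin.<-irrefl refl a<a)
    edge-constraint x (inj₂ (a<a , _))  | tri≈ _ refl _ = ⊥-elim (Fin.<-irrefl refl a<a)
    edge-constraint x (inj₁ (a<b , _))  | tri> _ _ b<a  = ⊥-elim (Fin.<-asym a<b b<a)
    edge-constraint x (inj₂ (_ , eq))   | tri> _ _ _    = eq

    listsOf : ℕ → List (List V)
    listsOf zero    = [] ∷ []
    listsOf (suc k) = cartesianProductWith _∷_ (allFin n) (listsOf k)

    length-listsOf : ∀ k → length (listsOf k) ≡ n ^ k
    length-listsOf zero    = refl
    length-listsOf (suc k) = trans (length-cartesianProductWith _∷_ (allFin n) (listsOf k))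
                                   (cong₂ _*_ (length-tabulate {n = n} (λ i → i)) (length-listsOf k))

    ∈-listsOf : ∀ vs → vs ∈ listsOf (length vs)
    ∈-listsOf []       = here refl
    ∈-listsOf (v ∷ vs) = ∈-cartesianProductWith⁺ _∷_ (∈-allFin v) (∈-listsOf vs)

    module _ (T : Tournament n) where
      private E = Edge T

      edge⇒≢ : ∀ {u v} → E u v → u ≢ v
      edge⇒≢ {u} e refl = Tournament.irrefl T u e

      chain-edges : ∀ {vs} → AllPairs E vs → All (λ { (a , b) → E a b }) (chainPairs vs)
      chain-edges []         = []
      chain-edges (es ∷ ess) = All.++⁺ (All.map⁺ es) (chain-edges ess)

      path-edges : ∀ vs → IsPath T vs → All (λ { (a , b) → E a b }) (pathPairs vs)
      path-edges []           _             = []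
      path-edges (_ ∷ [])     _             = []
      path-edges (v ∷ w ∷ vs) (e , es , p) = e ∷ All.++⁺ (All.map⁺ es) (path-edges (w ∷ vs) p)

      path-unique : ∀ vs → IsPath T vs → Unique vs
      path-unique []           _            = []
      path-unique (_ ∷ [])     _            = [] ∷ []
      path-unique (v ∷ w ∷ vs) (e , es , p) = (≢-sym (edge⇒≢ e) ∷ All.map edge⇒≢ es) ∷ path-unique (w ∷ vs) p

    -- Each of the at most `n ^ k` lists of distinct vertices contributes two events, being a chain
    -- and being a path, and each of these fixes `tri k` distinct bits.
    random-tournament : ∀ k → 2 * n ^ k < 2 ^ tri k →
      ∃ λ (T : Tournament n) → ∀ vs → length vs ≡ k → ¬ AllPairs (Edge T) vs × ¬ IsPath T vs
    random-tournament k few =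
      let x , avoid = union-bound (tri k) css (All.++⁺ good₁ good₂) few′
          T = fromBits x
      in T , λ vs len →
        (λ vs! → All.lookup avoid (∈-++⁺ˡ (∈-map⁺ _ (∈us vs len (AllPairs.map (edge⇒≢ T) vs!))))
                   (All.map⁺ (All.map (λ { {a , b} → edge-constraint x {a} {b} }) (chain-edges T vs!)))) ,
        (λ path → All.lookup avoid
                    (∈-++⁺ʳ (map (map constraint ∘ chainPairs) us) (∈-map⁺ _ (∈us vs len (path-unique T vs path))))
                    (All.map⁺ (All.map (λ { {a , b} → edge-constraint x {a} {b} }) (path-edges T vs path))))
      where
      uniq? = unique? (Fin._≟_ {n})
      -- A repeated vertex would repeat coordinates and spoil the count. The restriction loses
      -- nothing, as the vertices of a chain or a path are distinct.
      us = filter uniq? (listsOf k)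
      css = map (map constraint ∘ chainPairs) us ++ map (map constraint ∘ pathPairs) us

      ∈us : ∀ vs → length vs ≡ k → Unique vs → vs ∈ us
      ∈us vs refl u = ∈-filter⁺ uniq? (∈-listsOf vs) u

      few′ : length css < 2 ^ tri k
      few′ = begin-strict
        length css                     ≡⟨ length-++ (map (map constraint ∘ chainPairs) us) ⟩
        _                              ≡⟨ cong₂ _+_ (length-map _ us) (length-map _ us) ⟩
        length us + length us          ≤⟨ +-mono-≤ ∣us∣≤ ∣us∣≤ ⟩
        n ^ k + n ^ k                  ≡⟨ cong (n ^ k +_) (+-identityʳ _) ⟨
        2 * n ^ k                      <⟨ few ⟩
        2 ^ tri k                      ∎
        where
        open ≤-Reasoning
        ∣us∣≤ : length us ≤ n ^ k
        ∣us∣≤ = ≤-trans (length-filter uniq? (listsOf k)) (≤-reflexive (length-listsOf k))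

      listsOf-length : ∀ k → All (λ vs → length vs ≡ k) (listsOf k)
      listsOf-length zero    = refl ∷ []
      listsOf-length (suc k) = All.cartesianProductWith⁺ (setoid V) (setoid _) _∷_ (allFin n) (listsOf k)
        (λ _ vs∈ → cong suc (All.lookup (listsOf-length k) vs∈))

      us-good : All (λ vs → Unique vs × length vs ≡ k) us
      us-good = All.zip (All.all-filter uniq? (listsOf k) , All.filter⁺ uniq? (listsOf-length k))

      Good : List (Constraint (n * n)) → Set
      Good cs = Unique (map proj₁ cs) × length cs ≡ tri k

      good₁ : All Good (map (map constraint ∘ chainPairs) us)
      good₁ = All.map⁺ (All.map (λ { {vs} (u , len) →
        subst Unique (map-∘ (chainPairs vs)) (keys-unique vs u) ,
        trans (length-map constraint (chainPairs vs)) (trans (length-chainPairs vs) (cong tri len)) }) us-good)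

      good₂ : All Good (map (map constraint ∘ pathPairs) us)
      good₂ = All.map⁺ (All.map (λ { {vs} (u , len) →
        subst Unique (map-∘ (pathPairs vs)) (subst Unique (sym (pathKeys vs)) (keys-unique vs u)) ,
        trans (length-map constraint (pathPairs vs))
          (trans (sym (length-map key (pathPairs vs)))
            (trans (cong length (pathKeys vs))
              (trans (length-map key (chainPairs vs)) (trans (length-chainPairs vs) (cong tri len))))) }) us-good)

  -- Exponents

  module _ {n} (T : Tournament n) where
    private
      V = Fin n
      E = Edge T

    tabulate-path : ∀ {k} (h : Fin k → V) → (∀ {i j} → PathEdge i j → E (h i) (h j)) → IsPath T (tabulate h)
    tabulate-path {zero}        h hom = _
    tabulate-path {suc zero}    h hom = _
    tabulate-path {suc (suc k)} h hom =
      hom (inj₁ refl) , All.tabulate⁺ (λ i → hom (inj₂ (s≤s z≤n , λ ()))) , tabulate-path (h ∘ suc) (hom ∘ shift)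
      where
      shift : ∀ {i j : Fin (suc k)} → PathEdge i j → PathEdge (suc i) (suc j)
      shift (inj₁ eq)       = inj₁ (cong suc eq)
      shift (inj₂ (lt , ≢)) = inj₂ (s≤s lt , ≢ ∘ suc-injective)

    pathless⇒free : ∀ k → (∀ vs → length vs ≡ k → ¬ IsPath T vs) → P k -Free T
    pathless⇒free k pathless (m , f , iso) =
      pathless (tabulate h) (length-tabulate h) (tabulate-path h hom)
      where
      open _≅_ iso
      open Inverse bijection using (to; from; strictlyInverseˡ)
      h : Fin k → V
      h i = Injection.to f (from i)
      hom : ∀ {i j} → PathEdge i j → E (h i) (h j)
      hom {i} {j} e = Equivalence.from (edges (from i) (from j))
        (subst₂ PathEdge (sym (strictlyInverseˡ i)) (sym (strictlyInverseˡ j)) e)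

    module _ (acyclic : Transitive T) where

      edge-trans : ∀ {a b c} → E a b → E b c → E a c
      edge-trans {a} {b} {c} ab bc with edge? T a c
      ... | yes ac = ac
      ... | no ¬ac = ⊥-elim (acyclic (record { ℓ = 2 ; c = vertex ; distinct = distinct ; step = step ; close = ca }))
        where
        a≢c : a ≢ c
        a≢c refl = edge-asym T ab bc
        ca : E c a
        ca = edge-total T a≢c ¬ac
        vertex : Fin 3 → V
        vertex zero             = a
        vertex (suc zero)       = b
        vertex (suc (suc zero)) = c
        distinct : ∀ {i j} → vertex i ≡ vertex j → i ≡ j
        distinct {zero}           {zero}           _  = refl
        distinct {zero}           {suc zero}       eq = ⊥-elim (edge⇒≢ T ab eq)
        distinct {zero}           {suc (suc zero)} eq = ⊥-elim (a≢c eq)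
        distinct {suc zero}       {zero}           eq = ⊥-elim (edge⇒≢ T ab (sym eq))
        distinct {suc zero}       {suc zero}       _  = refl
        distinct {suc zero}       {suc (suc zero)} eq = ⊥-elim (edge⇒≢ T bc eq)
        distinct {suc (suc zero)} {zero}           eq = ⊥-elim (a≢c (sym eq))
        distinct {suc (suc zero)} {suc zero}       eq = ⊥-elim (edge⇒≢ T bc (sym eq))
        distinct {suc (suc zero)} {suc (suc zero)} _  = refl
        step : ∀ i → E (vertex (Fin.inject₁ i)) (vertex (suc i))
        step zero       = ab
        step (suc zero) = bc

      -- One step of an insertion sort by `Edge`, which `edge-trans` makes a strict linear order.
      insert : ∀ v ys → All (v ≢_) ys → AllPairs E ys →
               ∃ λ zs → AllPairs E zs × length zs ≡ suc (length ys) × All (_∈ v ∷ ys) zs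
      insert v []       _          _           = v ∷ [] , [] ∷ [] , refl , here refl ∷ []
      insert v (y ∷ ys) (v≢y ∷ v∉) (es ∷ ess) with edge? T v y
      ... | yes vy = v ∷ y ∷ ys , (vy ∷ All.map (edge-trans vy) es) ∷ es ∷ ess , refl , All.tabulate (λ z∈ → z∈)
      ... | no ¬vy =
        let zs , zs! , len , zs∈ = insert v ys v∉ ess
        in y ∷ zs , All.map (λ z∈ → All.lookup (edge-total T v≢y ¬vy ∷ es) z∈) zs∈ ∷ zs! , cong suc len ,
           there (here refl) ∷ All.map weaken zs∈
        where
        weaken : ∀ {z} → z ∈ v ∷ ys → z ∈ v ∷ y ∷ ys
        weaken (here eq)  = here eq
        weaken (there z∈) = there (there z∈)

      sort : ∀ xs → Unique xs → ∃ λ zs → AllPairs E zs × length zs ≡ length xs × All (_∈ xs) zs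
      sort []       []       = [] , [] , refl , []
      sort (x ∷ xs) (x∉ ∷ u) =
        let ys , ys! , len , ys∈ = sort xs u
            zs , zs! , len′ , zs∈ = insert x ys (All.map (All.lookup x∉) ys∈) ys!
        in zs , zs! , trans len′ (cong suc len) , All.map (λ z∈ → All.lookup (here refl ∷ All.map there ys∈) z∈) zs∈

      acyclic⇒chain : ∃ λ zs → AllPairs E zs × length zs ≡ n
      acyclic⇒chain = let zs , zs! , len , _ = sort (allFin n) (allFin⁺ n)
                      in zs , zs! , trans len (length-tabulate {n = n} (λ i → i))

  chainless⇒small : ∀ {n} (T : Tournament n) k → (∀ vs → length vs ≡ k → ¬ AllPairs (Edge T) vs) →
                    ∀ {m} (f : Fin m ↣ Fin n) → Transitive (induced T f) → m < k
  chainless⇒small T k chainless {m} f acyclic with m <? k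
  ... | yes m<k = m<k
  ... | no  m≮k =
    let zs , zs! , len = acyclic⇒chain (induced T f) acyclic
        ws = map (Injection.to f) zs
    in ⊥-elim (chainless (take k ws)
         (trans (length-take k ws) (m≤n⇒m⊓n≡m (≤-trans (≮⇒≥ m≮k) (≤-reflexive (sym (trans (length-map _ zs) len))))))
         (AllPairs.take⁺ k (AllPairs.map⁺ zs!)))

  -- The upper bound for exponents

  2*tri : ∀ k → 2 * tri (suc k) ≡ suc k * k
  2*tri zero    = refl
  2*tri (suc k) = trans (*-distribˡ-+ 2 (suc k) (tri (suc k))) (trans (cong (λ z → 2 * suc k + z) (2*tri k)) (lemma k))
    where
    lemma : ∀ k → 2 * suc k + suc k * k ≡ suc (suc k) * suc k
    lemma = solve-∀

  -- Multiplied by 4, this follows from 4 + k² < 2 k (k - 1), which holds from k = 4 on. The summand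
  -- 1 stands for the factor 2 of the union bound.
  tri-large : ∀ k → 4 ≤ k → 1 + (k / 4) * k < tri k
  tri-large k@(suc (suc (suc (suc x)))) (s≤s (s≤s (s≤s (s≤s _)))) = *-cancelˡ-< 4 _ _ (begin-strict
    4 * (1 + k / 4 * k)        ≡⟨ lemma₁ (k / 4) k ⟩
    4 + k / 4 * 4 * k          ≤⟨ +-monoʳ-≤ 4 (*-monoˡ-≤ k (m/n*n≤m k 4)) ⟩
    4 + k * k                  <⟨ ≤-trans (m≤m+n _ (3 + 6 * x + x * x)) (≤-reflexive (lemma₂ x)) ⟩
    2 * (k * (3 + x))          ≡⟨ cong (2 *_) (2*tri (3 + x)) ⟨
    2 * (2 * tri k)            ≡⟨ *-assoc 2 2 (tri k) ⟨
    4 * tri k                  ∎)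
    where
    open ≤-Reasoning
    lemma₁ : ∀ j k → 4 * (1 + j * k) ≡ 4 + j * 4 * k
    lemma₁ = solve-∀
    lemma₂ : ∀ x → 5 + (4 + x) * (4 + x) + (3 + 6 * x + x * x) ≡ 2 * ((4 + x) * (3 + x))
    lemma₂ = solve-∀

  2^-cancel-≤ : ∀ m n → 2 ^ m ≤ 2 ^ n → m ≤ n
  2^-cancel-≤ m n h = ≮⇒≥ (λ n<m → <⇒≱ (^-monoʳ-< 2 (s≤s (s≤s z≤n)) n<m) h)

  -- This is e ≤ 8 g / k with the denominators cleared. The 8 combines the 4 in `k / 4` with a
  -- factor 2 for rounding that quotient down.
  EHExponent-upper : ∀ k g e → 4 ≤ k → k ≤ 2 ^ g → EHExponent (P k) e → k * ∣ ↥ e ∣ ≤ 8 * g * ↧ₙ e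
  EHExponent-upper k g e 4≤k k≤ (_ , eh) = bound
    where
    open ≤-Reasoning
    j = k / 4
    a = ∣ ↥ e ∣
    b = ↧ₙ e

    few : 2 * (2 ^ j) ^ k < 2 ^ tri k
    few = begin-strict
      2 * (2 ^ j) ^ k    ≡⟨ cong (2 *_) (^-*-assoc 2 j k) ⟩
      2 ^ (1 + j * k)    <⟨ ^-monoʳ-< 2 (s≤s (s≤s z≤n)) (tri-large k 4≤k) ⟩
      2 ^ tri k          ∎

    ja≤gb : j * a ≤ g * b
    ja≤gb =
      let T , avoids = random-tournament k few
          m , f , acyclic , n^a≤m^b = eh (2 ^ j) (m^n>0 2 j) T (pathless⇒free T k (λ vs len → proj₂ (avoids vs len)))
          m<k = chainless⇒small T k (λ vs len → proj₁ (avoids vs len)) f acyclic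
      in 2^-cancel-≤ _ _ (begin
        2 ^ (j * a)   ≡⟨ ^-*-assoc 2 j a ⟨
        (2 ^ j) ^ a   ≤⟨ n^a≤m^b ⟩
        m ^ b         ≤⟨ ^-monoˡ-≤ b (≤-trans (<⇒≤ m<k) k≤) ⟩
        (2 ^ g) ^ b   ≡⟨ ^-*-assoc 2 g b ⟩
        2 ^ (g * b)   ∎)

    1≤j : 1 ≤ j
    1≤j = ≮⇒≥ (λ j<1 → <⇒≱ (m%n<n k 4) (begin
      4                ≤⟨ 4≤k ⟩
      k                ≡⟨ m≡m%n+[m/n]*n k 4 ⟩
      k % 4 + j * 4    ≡⟨ cong (λ z → k % 4 + z * 4) (n<1⇒n≡0 j<1) ⟩
      k % 4 + 0        ≡⟨ +-identityʳ _ ⟩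
      k % 4            ∎))

    k≤8j : k ≤ 8 * j
    k≤8j = begin
      k                 ≡⟨ m≡m%n+[m/n]*n k 4 ⟩
      k % 4 + j * 4     ≤⟨ +-monoˡ-≤ (j * 4) (<⇒≤ (m%n<n k 4)) ⟩
      4 * 1 + j * 4     ≤⟨ +-monoˡ-≤ (j * 4) (*-monoʳ-≤ 4 1≤j) ⟩
      4 * j + j * 4     ≡⟨ lemma j ⟩
      8 * j             ∎
      where
      lemma : ∀ j → 4 * j + j * 4 ≡ 8 * j
      lemma = solve-∀

    bound : k * a ≤ 8 * g * b
    bound = begin
      k * a          ≤⟨ *-monoˡ-≤ a k≤8j ⟩
      8 * j * a      ≡⟨ *-assoc 8 j a ⟩
      8 * (j * a)    ≤⟨ *-monoʳ-≤ 8 ja≤gb ⟩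
      8 * (g * b)    ≡⟨ *-assoc 8 g b ⟨
      8 * g * b      ∎

  -- Powers against exponentials

  ^-distribʳ-* : ∀ x y d → (x * y) ^ d ≡ x ^ d * y ^ d
  ^-distribʳ-* x y zero    = refl
  ^-distribʳ-* x y (suc d) = trans (cong (x * y *_) (^-distribʳ-* x y d)) (lemma x y (x ^ d) (y ^ d))
    where
    lemma : ∀ x y u v → x * y * (u * v) ≡ x * u * (y * v)
    lemma = solve-∀

  ^-cancelʳ-≤ : ∀ d {x y} .⦃ _ : NonZero d ⦄ → x ^ d ≤ y ^ d → x ≤ y
  ^-cancelʳ-≤ d h = ≮⇒≥ (λ y<x → <⇒≱ (^-monoˡ-< d y<x) h)

  1+n≤2^n : ∀ n → suc n ≤ 2 ^ n
  1+n≤2^n zero    = ≤-refl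
  1+n≤2^n (suc n) = begin
    suc (suc n)    ≤⟨ s≤s (1+n≤2^n n) ⟩
    1 + 2 ^ n      ≤⟨ +-mono-≤ (m^n>0 2 n) (m≤m+n (2 ^ n) 0) ⟩
    2 * 2 ^ n      ∎
    where open ≤-Reasoning

  -- From x ≤ s · 2 ^ (x / s).
  power≤exponential : ∀ s x .⦃ _ : NonZero s ⦄ → x ^ s ≤ s ^ s * 2 ^ x
  power≤exponential s x = begin
    x ^ s                        ≤⟨ ^-monoˡ-≤ s x≤ ⟩
    (s * 2 ^ (x / s)) ^ s        ≡⟨ ^-distribʳ-* s (2 ^ (x / s)) s ⟩
    s ^ s * (2 ^ (x / s)) ^ s    ≡⟨ cong (s ^ s *_) (^-*-assoc 2 (x / s) s) ⟩
    s ^ s * 2 ^ (x / s * s)      ≤⟨ *-monoʳ-≤ (s ^ s) (^-monoʳ-≤ 2 (m/n*n≤m x s)) ⟩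
    s ^ s * 2 ^ x                ∎
    where
    open ≤-Reasoning
    x≤ : x ≤ s * 2 ^ (x / s)
    x≤ = begin
      x                      ≡⟨ m≡m%n+[m/n]*n x s ⟩
      x % s + x / s * s      ≤⟨ +-monoˡ-≤ (x / s * s) (<⇒≤ (m%n<n x s)) ⟩
      suc (x / s) * s        ≡⟨ *-comm (suc (x / s)) s ⟩
      s * suc (x / s)        ≤⟨ *-monoʳ-≤ s (1+n≤2^n (x / s)) ⟩
      s * 2 ^ (x / s)        ∎

  threshold : ℕ → ℕ
  threshold r = 16 * ((2 * r) * (2 * r))

  -- With `s = 2 * r`, multiplying the left side by `s ^ s` gives (16 s² x) ^ r. The threshold is
  -- exactly 16 s², so this is at most x ^ s, and the same `s ^ s` appears in the bound for x ^ s
  -- and cancels.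
  power≪exponential : ∀ r x .⦃ _ : NonZero r ⦄ → threshold r ≤ x → (16 * x) ^ r ≤ 2 ^ x
  power≪exponential r@(suc _) x h = *-cancelˡ-≤ (s ^ s) ⦃ m^n≢0 s s ⦄ (begin
    s ^ s * (16 * x) ^ r         ≡⟨ cong (_* (16 * x) ^ r) (^-*-assoc s 2 r) ⟨
    (s ^ 2) ^ r * (16 * x) ^ r   ≡⟨ ^-distribʳ-* (s ^ 2) (16 * x) r ⟨
    (s ^ 2 * (16 * x)) ^ r       ≡⟨ cong (_^ r) (lemma s x) ⟩
    (16 * (s * s) * x) ^ r       ≤⟨ ^-monoˡ-≤ r (*-monoˡ-≤ x h) ⟩
    (x * x) ^ r                  ≡⟨ cong (λ z → (x * z) ^ r) (*-identityʳ x) ⟨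
    (x ^ 2) ^ r                  ≡⟨ ^-*-assoc x 2 r ⟩
    x ^ s                        ≤⟨ power≤exponential s x ⟩
    s ^ s * 2 ^ x                ∎)
    where
    open ≤-Reasoning
    s = 2 * r
    lemma : ∀ s x → s * (s * 1) * (16 * x) ≡ 16 * (s * s) * x
    lemma = solve-∀

  -- The left side is linear in k and quadratic in x. Writing both variables as successors makes the
  -- difference a polynomial with nonnegative coefficients; adding it turns the inequality into an
  -- identity.
  lossExponent-bound : ∀ k x → 1 ≤ k → 1 ≤ x → 2 * lossExponent (suc x) k ≤ k * (16 * x) ^ 2
  lossExponent-bound (suc k) (suc y) _ _ = ≤-trans (m≤m+n _ _) (≤-reflexive (lemma y k))
    where
    lemma : ∀ y k →
      2 * ((2 + y + 3) + (3 + (2 * (2 + y) + 7) * (1 + k)) * (2 + y + 2)) +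
        ((252 * (y * y) + 466 * y + 134) * (1 + k) + (8 * y + 34) * k)
      ≡ (1 + k) * (16 * (1 + y) * (16 * (1 + y) * 1))
    lemma = solve-∀

  bracket : ∀ N k → 2 ^ N ≤ k → ∃ λ x → N ≤ x × 2 ^ x ≤ k × k ≤ 2 ^ suc x
  bracket N k h with log-bracket 2 k ≤-refl (≤-trans (m^n>0 2 N) h)
  ... | x , lo , hi = x , s≤s⁻¹ N<1+x , lo , <⇒≤ hi
    where
    N<1+x : N < suc x
    N<1+x = ≰⇒> (λ 1+x≤N → <⇒≱ hi (≤-trans (^-monoʳ-≤ 2 1+x≤N) h))

  -- Comparison with powers of k

  module _ (p d-1 : ℕ) where

    private
      δ = mkℚᵘ (ℤ.+ suc p) d-1
      d = suc d-1
  
    atMostPower-1+δ : ∀ {k} r → AtMostPower r k (1ℚᵘ ℚ.+ δ) → ∣ ↥ r ∣ ^ d * k ^ (d + suc p) ≤ ↧ₙ r ^ d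
    atMostPower-1+δ {k} r h =
      subst₂ (λ d′ p′ → ∣ ↥ r ∣ ^ suc d′ * k ^ (suc d′ + suc p′) ≤ ↧ₙ r ^ suc d′)
        (+-identityʳ d-1) (*-identityʳ p) h

    private
      denominator : ↧ₙ (1ℚᵘ ℚ.- δ) ≡ d
      denominator = cong suc (+-identityʳ d-1)

      numerator : ↥ (1ℚᵘ ℚ.- δ) ≡ d ⊖ suc p
      numerator = cong₂ (λ d′ p′ → suc d′ ⊖ suc p′) (+-identityʳ d-1) (*-identityʳ p)

      -- `AtMostPower` branches on the numerator, which does not reduce to a constructor for
      -- `1ℚᵘ - δ`. For a general `s` the equation for the numerator can be matched.
      nonneg : ∀ {r k} s c → ↥ s ≡ ℤ.+ c → ∣ ↥ r ∣ ^ ↧ₙ s * k ^ c ≤ ↧ₙ r ^ ↧ₙ s → AtMostPower r k s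
      nonneg (mkℚᵘ _ _) c refl h = h

      negative : ∀ {r k} s c → ↥ s ≡ -[1+ c ] → ∣ ↥ r ∣ ^ ↧ₙ s ≤ ↧ₙ r ^ ↧ₙ s * k ^ suc c → AtMostPower r k s
      negative (mkℚᵘ _ _) c refl h = h

    -- As δ may exceed 1, the exponent 1 - δ can have either sign. The hypothesis keeps only
    -- nonnegative powers of k on its two sides; cancelling the smaller one gives either form.
    atMostPower-1-δ : ∀ {k} r → 1 ≤ k →
      ∣ ↥ r ∣ ^ d * k ^ d ≤ ↧ₙ r ^ d * k ^ suc p → AtMostPower r k (1ℚᵘ ℚ.- δ)
    atMostPower-1-δ {k} r 1≤k h with suc p ≤? d
    ... | yes p≤d = nonneg (1ℚᵘ ℚ.- δ) (d ∸ suc p)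
      (trans numerator (ℤ.⊖-≥ p≤d))
      (subst (λ d′ → ∣ ↥ r ∣ ^ d′ * k ^ (d ∸ suc p) ≤ ↧ₙ r ^ d′) (sym denominator)
        (*-cancelʳ-≤ _ _ (k ^ suc p) ⦃ m^n≢0 k (suc p) ⦃ >-nonZero 1≤k ⦄ ⦄ (begin
          a ^ d * k ^ (d ∸ suc p) * k ^ suc p     ≡⟨ *-assoc (a ^ d) _ _ ⟩
          a ^ d * (k ^ (d ∸ suc p) * k ^ suc p)   ≡⟨ cong (a ^ d *_) (^-distribˡ-+-* k (d ∸ suc p) (suc p)) ⟨
          a ^ d * k ^ (d ∸ suc p + suc p)         ≡⟨ cong (λ z → a ^ d * k ^ z) (m∸n+n≡m p≤d) ⟩
          a ^ d * k ^ d                           ≤⟨ h ⟩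
          ↧ₙ r ^ d * k ^ suc p                    ∎)))
      where
      open ≤-Reasoning
      a = ∣ ↥ r ∣
    ... | no p≰d = negative (1ℚᵘ ℚ.- δ) (p ∸ d)
      (trans numerator (trans (ℤ.⊖-< (≰⇒> p≰d)) (cong (λ z → ℤ.- (ℤ.+ z)) (+-∸-assoc 1 d≤p))))
      (subst (λ d′ → ∣ ↥ r ∣ ^ d′ ≤ ↧ₙ r ^ d′ * k ^ suc (p ∸ d)) (sym denominator)
        (*-cancelʳ-≤ _ _ (k ^ d) ⦃ m^n≢0 k d ⦃ >-nonZero 1≤k ⦄ ⦄ (begin
          ∣ ↥ r ∣ ^ d * k ^ d                     ≤⟨ h ⟩
          b ^ d * k ^ suc p                       ≡⟨ cong (λ z → b ^ d * k ^ suc z) (m∸n+n≡m d≤p) ⟨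
          b ^ d * k ^ (suc (p ∸ d) + d)           ≡⟨ cong (b ^ d *_) (^-distribˡ-+-* k (suc (p ∸ d)) d) ⟩
          b ^ d * (k ^ suc (p ∸ d) * k ^ d)       ≡⟨ *-assoc (b ^ d) _ _ ⟨
          b ^ d * k ^ suc (p ∸ d) * k ^ d         ∎)))
      where
      open ≤-Reasoning
      b = ↧ₙ r
      d≤p : d ≤ p
      d≤p = s≤s⁻¹ (≰⇒> p≰d)

    -- In the d-th power of 2L ≤ k (16 x)² the surplus over k ^ d is (16 x) ^ (2 d), hence the
    -- threshold at `d * 2`. It makes the surplus at most 2 ^ x and so at most one factor k, which
    -- is available because δ is at least 1/d.
    lower : ∀ k x → threshold (d * 2) ≤ x → 2 ^ x ≤ k → k ≤ 2 ^ suc x → k ^- (1ℚᵘ ℚ.+ δ) ≤ᴿ ε (P k)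
    lower k x N≤x 2^x≤k k≤ q (r , (0≤r , r≤) , q<r) =
      mkℚᵘ (ℤ.+ 1) (pred 2L) , EHExponent-path (suc x) k (pred 2L) k≤ (sym 2L≡) , ℚ.<-≤-trans q<r (r≤e r 0≤r r≤)
      where
      open ≤-Reasoning
      2L = 2 * lossExponent (suc x) k
      2L≡ : suc (pred 2L) ≡ 2L
      2L≡ = suc-pred 2L ⦃ >-nonZero (s≤s z≤n) ⦄
      1≤k : 1 ≤ k
      1≤k = ≤-trans (m^n>0 2 x) 2^x≤k
      1≤x : 1 ≤ x
      1≤x = ≤-trans (s≤s z≤n) N≤x

      2L^d≤ : 2L ^ d ≤ k ^ (d + suc p)
      2L^d≤ = begin
        2L ^ d                              ≤⟨ ^-monoˡ-≤ d (lossExponent-bound k x 1≤k 1≤x) ⟩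
        (k * (16 * x) ^ 2) ^ d              ≡⟨ ^-distribʳ-* k ((16 * x) ^ 2) d ⟩
        k ^ d * ((16 * x) ^ 2) ^ d          ≡⟨ cong (k ^ d *_) (^-*-assoc (16 * x) 2 d) ⟩
        k ^ d * (16 * x) ^ (2 * d)          ≡⟨ cong (λ z → k ^ d * (16 * x) ^ z) (*-comm 2 d) ⟩
        k ^ d * (16 * x) ^ (d * 2)          ≤⟨ *-monoʳ-≤ (k ^ d) (power≪exponential (d * 2) x N≤x) ⟩
        k ^ d * 2 ^ x                       ≤⟨ *-monoʳ-≤ (k ^ d) 2^x≤k ⟩
        k ^ d * k                           ≤⟨ *-monoʳ-≤ (k ^ d) (m≤m*n k (k ^ p) ⦃ m^n≢0 k p ⦃ >-nonZero 1≤k ⦄ ⦄) ⟩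
        k ^ d * k ^ suc p                   ≡⟨ ^-distribˡ-+-* k d (suc p) ⟨
        k ^ (d + suc p)                     ∎

      r≤e : ∀ r → 0ℚᵘ ℚ.≤ r → AtMostPower r k (1ℚᵘ ℚ.+ δ) → r ℚ.≤ mkℚᵘ (ℤ.+ 1) (pred 2L)
      r≤e (mkℚᵘ -[1+ _ ] _)  (*≤* ()) _
      r≤e r@(mkℚᵘ (ℤ.+ a) b-1) _ r≤ = *≤* (subst₂ ℤ._≤_ (ℤ.pos-* a (suc (pred 2L))) (ℤ.pos-* 1 (suc b-1))
        (+≤+ (begin
          a * suc (pred 2L)   ≡⟨ cong (a *_) 2L≡ ⟩
          a * 2L              ≤⟨ ^-cancelʳ-≤ d power ⟩
          suc b-1             ≡⟨ *-identityˡ _ ⟨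
          1 * suc b-1         ∎)))
        where
        power : (a * 2L) ^ d ≤ suc b-1 ^ d
        power = begin
          (a * 2L) ^ d               ≡⟨ ^-distribʳ-* a 2L d ⟩
          a ^ d * 2L ^ d             ≤⟨ *-monoʳ-≤ (a ^ d) 2L^d≤ ⟩
          a ^ d * k ^ (d + suc p)    ≤⟨ atMostPower-1+δ {k} r r≤ ⟩
          suc b-1 ^ d                ∎

    upper : ∀ k x → threshold (d * 2) ≤ x → 2 ^ x ≤ k → k ≤ 2 ^ suc x → ε (P k) ≤ᴿ k ^- (1ℚᵘ ℚ.- δ)
    upper k x N≤x 2^x≤k k≤ q (e , eh@(0≤e , _) , q<e) = e , (0≤e , atMostPower-1-δ e 1≤k power) , q<e
      where
      open ≤-Reasoning
      a = ∣ ↥ e ∣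
      b = ↧ₙ e
      16≤x : 16 ≤ x
      16≤x = ≤-trans (m≤m*n 16 (2 * (d * 2) * (2 * (d * 2)))) N≤x
      1≤x : 1 ≤ x
      1≤x = ≤-trans (s≤s z≤n) 16≤x
      1≤k : 1 ≤ k
      1≤k = ≤-trans (m^n>0 2 x) 2^x≤k
      4≤k : 4 ≤ k
      4≤k = ≤-trans (^-monoʳ-≤ 2 (≤-trans (s≤s (s≤s z≤n)) 16≤x)) 2^x≤k

      8g≤16x : 8 * suc x ≤ 16 * x
      8g≤16x = begin
        8 * suc x        ≤⟨ *-monoʳ-≤ 8 (+-monoˡ-≤ x 1≤x) ⟩
        8 * (x + x)      ≡⟨ lemma x ⟩
        16 * x           ∎
        where
        lemma : ∀ x → 8 * (x + x) ≡ 16 * x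
        lemma = solve-∀

      [8g]^d≤k^ : (8 * suc x) ^ d ≤ k ^ suc p
      [8g]^d≤k^ = begin
        (8 * suc x) ^ d       ≤⟨ ^-monoˡ-≤ d 8g≤16x ⟩
        (16 * x) ^ d          ≤⟨ ^-monoʳ-≤ (16 * x) ⦃ >-nonZero (≤-trans 1≤x (m≤n*m x 16)) ⦄ (m≤m*n d 2) ⟩
        (16 * x) ^ (d * 2)    ≤⟨ power≪exponential (d * 2) x N≤x ⟩
        2 ^ x                 ≤⟨ 2^x≤k ⟩
        k                     ≤⟨ m≤m*n k (k ^ p) ⦃ m^n≢0 k p ⦃ >-nonZero 1≤k ⦄ ⦄ ⟩
        k ^ suc p             ∎

      power : a ^ d * k ^ d ≤ b ^ d * k ^ suc p
      power = begin
        a ^ d * k ^ d                ≡⟨ ^-distribʳ-* a k d ⟨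
        (a * k) ^ d                  ≡⟨ cong (_^ d) (*-comm a k) ⟩
        (k * a) ^ d                  ≤⟨ ^-monoˡ-≤ d (EHExponent-upper k (suc x) e 4≤k k≤ eh) ⟩
        (8 * suc x * b) ^ d          ≡⟨ ^-distribʳ-* (8 * suc x) b d ⟩
        (8 * suc x) ^ d * b ^ d      ≤⟨ *-monoˡ-≤ (b ^ d) [8g]^d≤k^ ⟩
        k ^ suc p * b ^ d            ≡⟨ *-comm (k ^ suc p) (b ^ d) ⟩
        b ^ d * k ^ suc p            ∎

open import Data.Integer.Base using (+_; -[1+_]; +<+)
open import Data.Nat.Base using (ℕ; zero; suc; _^_; _*_) renaming (_≤_ to _≤ℕ_)
open import Data.Product.Base using (Σ; _×_; _,_)
open import Data.Rational.Unnormalised.Base using (ℚᵘ; 0ℚᵘ; 1ℚᵘ; mkℚᵘ; *<*; _<_; _+_; _-_)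
open Coefficients using (threshold; bracket; lower; upper)

theorem3p5 : (δ : ℚᵘ) → 0ℚᵘ < δ →
    Σ ℕ λ K → (k : ℕ) → K ≤ℕ k →
    (k ^- (1ℚᵘ + δ) ≤ᴿ ε (P k)) × (ε (P k) ≤ᴿ k ^- (1ℚᵘ - δ))
theorem3p5 (mkℚᵘ (+ zero) _)    (*<* (+<+ ()))
theorem3p5 (mkℚᵘ -[1+ _ ] _)    (*<* ())
theorem3p5 (mkℚᵘ (+ suc p) d-1) _ = 2 ^ N , λ k 2^N≤k →
  let x , N≤x , 2^x≤k , k≤ = bracket N k 2^N≤k
  in lower p d-1 k x N≤x 2^x≤k k≤ , upper p d-1 k x N≤x 2^x≤k k≤
  where N = threshold (suc d-1 * 2)
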